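{- For every even $n\ge 4$, the code $\mathcal{F}_n = \{ [n], \{1\}, \{2\}, \ldots, \{n\}, \emptyset \}\subseteq 2^{[n]}$ has $\operatorname{bdim}(\mathcal{F}_n) = n/2$, while on the other hand $\operatorname{odim}(\mathcal{F}_n) = \operatorname{cdim}(\mathcal{F}_n) = 2$.
   Context: Write $[n]=\{1,\ldots,n\}$. A code is a set $\mathcal{C}\subseteq 2^{[n]}$. For an ordered (indexed) collection $\mathcal{U} = \{U_1, \ldots, U_n\}$ of sets in $\mathbb{R}^d$, its code is $$\operatorname{code}(\mathcal{U}) = \{\sigma\subseteq [n] \mid \text{there exists } p\in \mathbb{R}^d \text{ such that for all } i\in[n],\ p\in U_i \text{ if and only if } i\in\sigma\},$$ and $\mathcal{U}$ is called a realization of $\operatorname{code}(\mathcal{U})$. By standing convention, all sets in realizations are bounded. An axis-parallel box (box for short) in $\mathbb{R}^d$ is either the empty set or a product $[a_1,b_1]\times\cdots\times[a_d,b_d]$ of nonempty closed intervals (degenerate intervals $a_i=b_i$ allowed). $\operatorname{odim}(\mathcal{C})$ (respectively $\operatorname{cdim}(\mathcal{C})$, $\operatorname{bdim}(\mathcal{C})$) is the minimum $d$ such that $\mathcal{C}$ has a realization in $\mathbb{R}^d$ in which every set is open and convex (respectively closed and convex, a box). The minimum over the empty set is $\infty$. -}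

module Defs where

open import Data.Fin using (Fin)
open import Data.Fin.Subset using (Subset; ⁅_⁆; _∈_) renaming (⊤ to full; ⊥ to ∅)
open import Data.Nat using (ℕ; _⊔_) renaming (_≤_ to _≤ⁿ_)
open import Data.Nat.Properties using (m⊔n≤o⇒m≤o; m⊔n≤o⇒n≤o)
  renaming (≤-refl to ≤ⁿ-refl)
open import Data.Product using (Σ-syntax; ∃-syntax; _×_; _,_; proj₁; proj₂)
open import Data.Rational as ℚ using (ℚ; 0ℚ; 1ℚ; ½)
import Data.Rational.Properties as ℚₚ
open import Data.Rational.Solver using (module +-*-Solver)
open import Data.Sum using (_⊎_)
open import Data.Vec.Functional using (Vector)
open import Function.Bundles using (_⇔_)
open import Level using (0ℓ)
open import Relation.Binary.PropositionalEquality using (_≡_; refl; sym; trans; cong; subst)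
open import Relation.Nullary using (¬_)
open import Relation.Nullary.Construct.Add.Supremum using (_⁺; ⊤⁺; [_])
open import Relation.Unary using (Pred; _≐_; Empty)

-- Real numbers are Cauchy sequences of rationals, compared by a setoid
-- equality.  The order is Bishop's: x < y carries a positive rational gap
-- that eventually separates the sequences, and x ≤ y is its negated converse.

IsCauchy : (ℕ → ℚ) → Set
IsCauchy x = ∀ ε → 0ℚ ℚ.< ε →
  ∃[ N ] (∀ m n → N ≤ⁿ m → N ≤ⁿ n → ℚ.∣ x m ℚ.- x n ∣ ℚ.< ε)

record ℝ : Set where
  constructor mkℝ
  field
    seq    : ℕ → ℚ
    cauchy : IsCauchy seq

open ℝ public

module _ where
  open import Data.Rational hiding (_⊔_)
  open +-*-Solver
  open ℚₚ.≤-Reasoning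

  abstract
    private
      0<ε*½ : ∀ {ε} → 0ℚ < ε → 0ℚ < ε * ½
      0<ε*½ {ε} 0<ε = subst (_< ε * ½) (ℚₚ.*-zeroˡ ½) (ℚₚ.*-monoˡ-<-pos ½ 0<ε)

      ε*½+ε*½ : ∀ ε → ε * ½ + ε * ½ ≡ ε
      ε*½+ε*½ ε = trans (sym (ℚₚ.*-distribˡ-+ ε ½ ½)) (ℚₚ.*-identityʳ ε)

    const-cauchy : ∀ q → IsCauchy (λ _ → q)
    const-cauchy q ε 0<ε = 0 , λ _ _ _ _ →
      subst (_< ε) (cong ∣_∣ (sym (ℚₚ.+-inverseʳ q))) 0<ε

    neg-cauchy : ∀ x → IsCauchy x → IsCauchy (λ n → - x n)
    neg-cauchy x cx ε 0<ε with cx ε 0<ε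
    ... | N , h = N , λ m n N≤m N≤n → begin-strict
      ∣ - x m - - x n ∣  ≡⟨ cong ∣_∣ (solve 2 (λ a b → :- a :+ :- (:- b) := :- (a :+ :- b)) refl (x m) (x n)) ⟩
      ∣ - (x m - x n) ∣  ≡⟨ ℚₚ.∣-p∣≡∣p∣ (x m - x n) ⟩
      ∣ x m - x n ∣      <⟨ h m n N≤m N≤n ⟩
      ε                  ∎

    +-cauchy : ∀ x y → IsCauchy x → IsCauchy y → IsCauchy (λ n → x n + y n)
    +-cauchy x y cx cy ε 0<ε with cx (ε * ½) (0<ε*½ 0<ε) | cy (ε * ½) (0<ε*½ 0<ε)
    ... | N₁ , h₁ | N₂ , h₂ = N₁ ⊔ N₂ , λ m n N≤m N≤n → begin-strict
      ∣ (x m + y m) - (x n + y n) ∣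
        ≡⟨ cong ∣_∣ (solve 4 (λ a b c d → (a :+ b) :+ :- (c :+ d) := (a :+ :- c) :+ (b :+ :- d)) refl
                      (x m) (y m) (x n) (y n)) ⟩
      ∣ (x m - x n) + (y m - y n) ∣
        ≤⟨ ℚₚ.∣p+q∣≤∣p∣+∣q∣ (x m - x n) (y m - y n) ⟩
      ∣ x m - x n ∣ + ∣ y m - y n ∣
        <⟨ ℚₚ.+-mono-< (h₁ m n (m⊔n≤o⇒m≤o N₁ N₂ N≤m) (m⊔n≤o⇒m≤o N₁ N₂ N≤n))
                      (h₂ m n (m⊔n≤o⇒n≤o N₁ N₂ N≤m) (m⊔n≤o⇒n≤o N₁ N₂ N≤n)) ⟩
      ε * ½ + ε * ½
        ≡⟨ ε*½+ε*½ ε ⟩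
      ε ∎

    cauchy⇒bounded : ∀ x → IsCauchy x →
      Σ[ B ∈ ℚ ] 0ℚ < B × ∃[ N ] (∀ n → N ≤ⁿ n → ∣ x n ∣ < B)
    cauchy⇒bounded x cx with cx 1ℚ (ℚₚ.positive⁻¹ 1ℚ)
    ... | N , h = 1ℚ + ∣ x N ∣
                , ℚₚ.+-mono-<-≤ (ℚₚ.positive⁻¹ 1ℚ) (ℚₚ.0≤∣p∣ (x N))
                , N
                , λ n N≤n → begin-strict
      ∣ x n ∣                  ≡⟨ cong ∣_∣ (solve 2 (λ a b → a := (a :+ :- b) :+ b) refl (x n) (x N)) ⟩
      ∣ (x n - x N) + x N ∣    ≤⟨ ℚₚ.∣p+q∣≤∣p∣+∣q∣ (x n - x N) (x N) ⟩
      ∣ x n - x N ∣ + ∣ x N ∣  <⟨ ℚₚ.+-monoˡ-< ∣ x N ∣ (h n N N≤n ≤ⁿ-refl) ⟩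
      1ℚ + ∣ x N ∣             ∎

    private
      quotient : ∀ {ε C} → 0ℚ < ε → 0ℚ < C → Σ[ δ ∈ ℚ ] 0ℚ < δ × C * δ ≡ ε
      quotient {ε} {C} 0<ε 0<C = 1/ C * ε , 0<δ , C*δ≡ε
        where
        instance
          C-pos : Positive C
          C-pos = positive 0<C

          C-nonZero : NonZero C
          C-nonZero = ℚₚ.pos⇒nonZero C

        0<δ : 0ℚ < 1/ C * ε
        0<δ = subst (_< 1/ C * ε) (ℚₚ.*-zeroʳ (1/ C))
                (ℚₚ.*-monoʳ-<-pos (1/ C) {{ℚₚ.1/pos⇒pos C}} 0<ε)

        C*δ≡ε : C * (1/ C * ε) ≡ ε
        C*δ≡ε = trans (sym (ℚₚ.*-assoc C (1/ C) ε))
                  (trans (cong (_* ε) (ℚₚ.*-inverseʳ C)) (ℚₚ.*-identityˡ ε))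

      ∣p*q∣≤∣p∣*δ : ∀ {δ} p q → ∣ q ∣ < δ → ∣ p * q ∣ ≤ ∣ p ∣ * δ
      ∣p*q∣≤∣p∣*δ {δ} p q ∣q∣<δ = begin
        ∣ p * q ∣      ≡⟨ ℚₚ.∣p*q∣≡∣p∣*∣q∣ p q ⟩
        ∣ p ∣ * ∣ q ∣  ≤⟨ ℚₚ.*-monoˡ-≤-nonNeg ∣ p ∣ {{ℚₚ.∣-∣-nonNeg p}} (ℚₚ.<⇒≤ ∣q∣<δ) ⟩
        ∣ p ∣ * δ      ∎

      *-close : ∀ {A B δ} a b c d → 0ℚ < δ → ∣ a ∣ < A → ∣ d ∣ < B →
        ∣ a - c ∣ < δ → ∣ b - d ∣ < δ → ∣ a * b - c * d ∣ < (A + B) * δ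
      *-close {A} {B} {δ} a b c d 0<δ ∣a∣<A ∣d∣<B ∣a-c∣<δ ∣b-d∣<δ = begin-strict
        ∣ a * b - c * d ∣
          ≡⟨ cong ∣_∣ (solve 4 (λ a b c d → a :* b :+ :- (c :* d) := a :* (b :+ :- d) :+ d :* (a :+ :- c)) refl
                        a b c d) ⟩
        ∣ a * (b - d) + d * (a - c) ∣
          ≤⟨ ℚₚ.∣p+q∣≤∣p∣+∣q∣ (a * (b - d)) (d * (a - c)) ⟩
        ∣ a * (b - d) ∣ + ∣ d * (a - c) ∣
          ≤⟨ ℚₚ.+-mono-≤ (∣p*q∣≤∣p∣*δ a (b - d) ∣b-d∣<δ) (∣p*q∣≤∣p∣*δ d (a - c) ∣a-c∣<δ) ⟩
        ∣ a ∣ * δ + ∣ d ∣ * δ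
          ≡⟨ sym (ℚₚ.*-distribʳ-+ δ ∣ a ∣ ∣ d ∣) ⟩
        (∣ a ∣ + ∣ d ∣) * δ
          <⟨ ℚₚ.*-monoˡ-<-pos δ {{positive 0<δ}} (ℚₚ.+-mono-< ∣a∣<A ∣d∣<B) ⟩
        (A + B) * δ
          ∎

    *-cauchy : ∀ x y → IsCauchy x → IsCauchy y → IsCauchy (λ n → x n * y n)
    *-cauchy x y cx cy ε 0<ε =
      let A , 0<A , N₁ , bx = cauchy⇒bounded x cx
          B , 0<B , N₂ , by = cauchy⇒bounded y cy
          δ , 0<δ , C*δ≡ε   = quotient 0<ε (ℚₚ.+-mono-< 0<A 0<B)
          N₃ , hx = cx δ 0<δ
          N₄ , hy = cy δ 0<δ
      in (N₁ ⊔ N₂) ⊔ (N₃ ⊔ N₄) , λ m n M≤m M≤n →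
        let N₁₂≤m = m⊔n≤o⇒m≤o (N₁ ⊔ N₂) (N₃ ⊔ N₄) M≤m
            N₃₄≤m = m⊔n≤o⇒n≤o (N₁ ⊔ N₂) (N₃ ⊔ N₄) M≤m
            N₁₂≤n = m⊔n≤o⇒m≤o (N₁ ⊔ N₂) (N₃ ⊔ N₄) M≤n
            N₃₄≤n = m⊔n≤o⇒n≤o (N₁ ⊔ N₂) (N₃ ⊔ N₄) M≤n
        in subst (∣ x m * y m - x n * y n ∣ <_) C*δ≡ε
             (*-close (x m) (y m) (x n) (y n) 0<δ
               (bx m (m⊔n≤o⇒m≤o N₁ N₂ N₁₂≤m))
               (by n (m⊔n≤o⇒n≤o N₁ N₂ N₁₂≤n))
               (hx m n (m⊔n≤o⇒m≤o N₃ N₄ N₃₄≤m) (m⊔n≤o⇒m≤o N₃ N₄ N₃₄≤n))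
               (hy m n (m⊔n≤o⇒n≤o N₃ N₄ N₃₄≤m) (m⊔n≤o⇒n≤o N₃ N₄ N₃₄≤n)))

infix  4 _≃_ _<_ _≤_
infixl 6 _+_ _-_
infixl 7 _*_
infix  8 -_

0ℝ 1ℝ : ℝ
0ℝ = mkℝ (λ _ → 0ℚ) (const-cauchy 0ℚ)
1ℝ = mkℝ (λ _ → 1ℚ) (const-cauchy 1ℚ)

_+_ _*_ : ℝ → ℝ → ℝ
x + y = mkℝ (λ n → seq x n ℚ.+ seq y n) (+-cauchy (seq x) (seq y) (cauchy x) (cauchy y))
x * y = mkℝ (λ n → seq x n ℚ.* seq y n) (*-cauchy (seq x) (seq y) (cauchy x) (cauchy y))

-_ : ℝ → ℝ
- x = mkℝ (λ n → ℚ.- seq x n) (neg-cauchy (seq x) (cauchy x))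

_-_ : ℝ → ℝ → ℝ
x - y = x + - y

_≃_ _<_ _≤_ : ℝ → ℝ → Set
x ≃ y = ∀ ε → 0ℚ ℚ.< ε → ∃[ N ] (∀ n → N ≤ⁿ n → ℚ.∣ seq x n ℚ.- seq y n ∣ ℚ.< ε)
x < y = Σ[ ε ∈ ℚ ] 0ℚ ℚ.< ε × ∃[ N ] (∀ n → N ≤ⁿ n → seq x n ℚ.+ ε ℚ.< seq y n)
x ≤ y = ¬ (y < x)

ℝ^ : ℕ → Set
ℝ^ d = Vector ℝ d

infix 4 _≋_ _∈ᴿ_

_≋_ : ∀ {d} → ℝ^ d → ℝ^ d → Set
p ≋ q = ∀ k → p k ≃ q k

-- A predicate on representatives is a set of points only if it respects ≋.
record Region (d : ℕ) : Set₁ where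
  field
    mem     : Pred (ℝ^ d) 0ℓ
    respect : ∀ {p q} → p ≋ q → mem p → mem q

open Region public

_∈ᴿ_ : ∀ {d} → ℝ^ d → Region d → Set
p ∈ᴿ U = mem U p

-- Sup-norm balls, which generate the usual topology of ℝᵈ.
Ball : ∀ {d} → ℝ^ d → ℝ → Pred (ℝ^ d) 0ℓ
Ball p r q = ∀ k → p k - r < q k × q k < p k + r

Open : ∀ {d} → Region d → Set
Open U = ∀ p → p ∈ᴿ U → ∃[ r ] (0ℝ < r × (∀ q → Ball p r q → q ∈ᴿ U))

-- U contains every point of its closure.
Closed : ∀ {d} → Region d → Set
Closed U = ∀ p → (∀ r → 0ℝ < r → ∃[ q ] (q ∈ᴿ U × Ball p r q)) → p ∈ᴿ U

Convex : ∀ {d} → Region d → Set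
Convex U = ∀ p q t → p ∈ᴿ U → q ∈ᴿ U → 0ℝ ≤ t → t ≤ 1ℝ →
  (λ k → (1ℝ - t) * p k + t * q k) ∈ᴿ U

Bounded : ∀ {d} → Region d → Set
Bounded U = ∃[ M ] (∀ p → p ∈ᴿ U → ∀ k → - M ≤ p k × p k ≤ M)

Box : ∀ {d} → Region d → Set
Box {d} U = Empty (mem U) ⊎
  (Σ[ a ∈ ℝ^ d ] Σ[ b ∈ ℝ^ d ]
    (∀ k → a k ≤ b k) × mem U ≐ (λ p → ∀ k → a k ≤ p k × p k ≤ b k))

Code : ℕ → Set₁
Code n = Pred (Subset n) 0ℓ

code : ∀ {n d} → Vector (Region d) n → Code n
code 𝓤 σ = ∃[ p ] (∀ i → p ∈ᴿ 𝓤 i ⇔ i ∈ σ)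

record Realization (Kind : ∀ {d} → Region d → Set) {n} (𝓒 : Code n) (d : ℕ) : Set₁ where
  field
    sets     : Vector (Region d) n
    kind     : ∀ i → Kind (sets i)
    bounded  : ∀ i → Bounded (sets i)
    realizes : code sets ≐ 𝓒

-- The minimum of { d ∣ P d } in ℕ ∪ {∞}, where ⊤⁺ is ∞.  It is a relation
-- because the minimum cannot be computed from P constructively.
data IsMin (P : ℕ → Set₁) : ℕ ⁺ → Set₁ where
  attained : ∀ {m} → P m → (∀ d → P d → m ≤ⁿ d) → IsMin P [ m ]
  infinite : (∀ d → ¬ P d) → IsMin P ⊤⁺

odim_≡_ cdim_≡_ bdim_≡_ : ∀ {n} → Code n → ℕ ⁺ → Set₁
odim 𝓒 ≡ m = IsMin (Realization (λ U → Open U × Convex U) 𝓒) m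
cdim 𝓒 ≡ m = IsMin (Realization (λ U → Closed U × Convex U) 𝓒) m
bdim 𝓒 ≡ m = IsMin (Realization Box 𝓒) m

𝓕 : ∀ n → Code n
𝓕 n σ = σ ≡ full ⊎ (∃[ i ] σ ≡ ⁅ i ⁆) ⊎ σ ≡ ∅

{-# OPTIONS --safe #-}
module Submission where

-- Upper bounds.  The 2 d segments from 0 to ± e k in ℝᵈ are boxes that pairwise
-- meet only in 0.  In the plane, let U i be a large square cut by all half-planes
-- y > 2 j x - j² with j ≠ i; any two of these sets intersect in the same polygon,
-- and (i , i² - ½) belongs to U i alone.  With ≥ in place of > the sets are closed.
--
-- Lower bounds.  From a common point o, leave U j for some j by changing one
-- coordinate of o to that of a private point x i of U i.  The coordinate and the
-- sign of the change determine i, so n ≤ 2 d.  For boxes this is n / 2 ≤ d; convex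
-- sets in dimension d ≤ 1 obey it too, so n ≥ 4 forces d ≥ 2.

-- Over these reals neither the order nor membership in a region is decidable, so no side of o and
-- no set that a point leaves can simply be picked. The bound n ≤ 2 d is decidable, hence stable
-- under double negation; all choices are made under ¬ ¬, and both fields of `BoxLike` conclude only
-- that much. In the plane convexity gives neither field: a diagonal segment violates `star`, a
-- triangle violates `span`. This is how the polygons evade the bound. The polygons rest on
-- omission: if the set i omits exactly the i-th half-plane of a list, two different sets together
-- impose the whole list. For private points no half-plane may be implied by the others, and the
-- tangents to a parabola supply arbitrarily many of this kind.

open import Data.Bool using (true)
open import Data.Fin using (Fin; zero; suc; combine; punchIn; toℕ)
import Data.Fin.Properties as Finₚ
open import Data.Fin.Subset using (Subset; ⁅_⁆; _∈_)
open import Data.Fin.Subset.Properties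
  using (_∈?_; ∈⊤; ∉⊥; ⊆⊤; ⊆-antisym; x∈⁅x⁆; x∈⁅y⁆⇒x≡y; Empty-unique)
open import Data.Nat using (ℕ; zero; suc; _⊔_; _/_; z≤n; s≤s)
  renaming (_≤_ to _≤ⁿ_; _<_ to _<ⁿ_; _+_ to _+ⁿ_; _*_ to _*ⁿ_)
open import Data.Nat.Divisibility using (_∣_; divides)
open import Data.Nat.DivMod using (m*n/n≡m)
import Data.Nat.Properties as ℕₚ
open import Data.Product using (Σ-syntax; ∃-syntax; _×_; _,_; proj₁; proj₂; map₂)
open import Data.Rational as ℚ using (ℚ; 0ℚ; 1ℚ; ½)
import Data.Rational.Properties as ℚₚ
open import Data.Rational.Solver using (module +-*-Solver)
open import Data.Sum using (_⊎_; inj₁; inj₂)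
open import Data.Vec using (tabulate)
open import Data.Vec.Functional using (Vector; updateAt)
open import Data.Vec.Functional.Properties using (updateAt-updates; updateAt-minimal)
open import Data.Vec.Properties using (lookup∘tabulate; []=⇒lookup; lookup⇒[]=)
open import Function.Base using (id; _∘_; case_of_) renaming (const to always)
open import Function.Bundles using (_⇔_; mk⇔; Equivalence)
open import Relation.Binary.Definitions using (tri<; tri≈; tri>)
open import Relation.Binary.PropositionalEquality
  using (_≡_; _≢_; refl; sym; ≢-sym; trans; cong; cong₂; subst; subst₂)
open import Relation.Nullary using (¬_; Dec; yes; no; does; contradiction; ¬?)
open import Relation.Nullary.Construct.Add.Supremum using ([_])
open import Relation.Nullary.Decidable
  using (decidable-stable; ¬¬-excluded-middle; _×-dec_; dec-true)
open import Relation.Unary using (_≐_)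

open +-*-Solver using (solve; con; _:=_; _:+_; _:*_; _:-_; :-_)

-- Rational inequalities

module _ where
  open import Data.Rational

  0<1 : 0ℚ < 1ℚ
  0<1 = ℚₚ.positive⁻¹ 1ℚ

  0<½ : 0ℚ < ½
  0<½ = ℚₚ.positive⁻¹ ½

  +-pos : ∀ {a b} → 0ℚ < a → 0ℚ < b → 0ℚ < a + b
  +-pos = ℚₚ.+-mono-<

  +-pos-nonNeg : ∀ {a b} → 0ℚ < a → 0ℚ ≤ b → 0ℚ < a + b
  +-pos-nonNeg = ℚₚ.+-mono-<-≤

  +-nonNeg : ∀ {a b} → 0ℚ ≤ a → 0ℚ ≤ b → 0ℚ ≤ a + b
  +-nonNeg = ℚₚ.+-mono-≤

  *-pos : ∀ {a b} → 0ℚ < a → 0ℚ < b → 0ℚ < a * b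
  *-pos {a} {b} 0<a 0<b =
    ℚₚ.positive⁻¹ (a * b) {{ℚₚ.pos*pos⇒pos a {{positive 0<a}} b {{positive 0<b}}}}

  *-nonNeg : ∀ {a b} → 0ℚ ≤ a → 0ℚ ≤ b → 0ℚ ≤ a * b
  *-nonNeg {a} {b} 0≤a 0≤b =
    ℚₚ.nonNegative⁻¹ (a * b) {{ℚₚ.nonNeg*nonNeg⇒nonNeg a {{nonNegative 0≤a}} b {{nonNegative 0≤b}}}}

  <⇒0< : ∀ {a b} → a < b → 0ℚ < b - a
  <⇒0< {a} {b} a<b = subst (_< b - a) (ℚₚ.+-inverseʳ a) (ℚₚ.+-monoˡ-< (- a) a<b)

  ≤⇒0≤ : ∀ {a b} → a ≤ b → 0ℚ ≤ b - a
  ≤⇒0≤ {a} {b} a≤b = subst (_≤ b - a) (ℚₚ.+-inverseʳ a) (ℚₚ.+-monoˡ-≤ (- a) a≤b)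

  private
    b-a+a : ∀ a b → b - a + a ≡ b
    b-a+a = solve 2 (λ a b → b :- a :+ a := b) refl

  0<⇒< : ∀ {a b c} → 0ℚ < c → c ≡ b - a → a < b
  0<⇒< {a} {b} 0<c refl =
    subst (_< b) (ℚₚ.+-identityˡ a) (subst (0ℚ + a <_) (b-a+a a b) (ℚₚ.+-monoˡ-< a 0<c))

  0≤⇒≤ : ∀ {a b c} → 0ℚ ≤ c → c ≡ b - a → a ≤ b
  0≤⇒≤ {a} {b} 0≤c refl =
    subst (_≤ b) (ℚₚ.+-identityˡ a) (subst (0ℚ + a ≤_) (b-a+a a b) (ℚₚ.+-monoˡ-≤ a 0≤c))

  half-pos : ∀ {ε} → 0ℚ < ε → 0ℚ < ε * ½
  half-pos 0<ε = *-pos 0<ε 0<½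

  p≤∣p∣ : ∀ p → p ≤ ∣ p ∣
  p≤∣p∣ p with ℚₚ.≤-total 0ℚ p
  ... | inj₁ 0≤p = ℚₚ.≤-reflexive (sym (ℚₚ.0≤p⇒∣p∣≡p 0≤p))
  ... | inj₂ p≤0 = ℚₚ.≤-trans p≤0 (ℚₚ.0≤∣p∣ p)

  ∣p-q∣≡∣q-p∣ : ∀ p q → ∣ p - q ∣ ≡ ∣ q - p ∣
  ∣p-q∣≡∣q-p∣ p q =
    trans (cong ∣_∣ (solve 2 (λ p q → p :- q := :- (q :- p)) refl p q)) (ℚₚ.∣-p∣≡∣p∣ (q - p))

  ∣-∣<⇒< : ∀ {a b ε} → ∣ a - b ∣ < ε → a < b + ε
  ∣-∣<⇒< {a} {b} {ε} h = 0<⇒< (<⇒0< (ℚₚ.≤-<-trans (p≤∣p∣ (a - b)) h))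
    (solve 3 (λ a b e → e :- (a :- b) := b :+ e :- a) refl a b ε)

  <⇒∣-∣< : ∀ {a b ε} → a < b + ε → b < a + ε → ∣ a - b ∣ < ε
  <⇒∣-∣< {a} {b} {ε} a<b+ε b<a+ε with ℚₚ.∣p∣≡p∨∣p∣≡-p (a - b)
  ... | inj₁ eq = subst (_< ε) (sym eq) (0<⇒< (<⇒0< a<b+ε)
    (solve 3 (λ a b e → b :+ e :- a := e :- (a :- b)) refl a b ε))
  ... | inj₂ eq = subst (_< ε) (sym eq) (0<⇒< (<⇒0< b<a+ε)
    (solve 3 (λ a b e → a :+ e :- b := e :- (:- (a :- b))) refl a b ε))

  quotient : ∀ {ε C} → 0ℚ < ε → 0ℚ < C → Σ[ δ ∈ ℚ ] 0ℚ < δ × C * δ ≡ ε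
  quotient {ε} {C} 0<ε 0<C = 1/ C * ε , *-pos 0<1/C 0<ε
    , trans (sym (ℚₚ.*-assoc C (1/ C) ε)) (trans (cong (_* ε) (ℚₚ.*-inverseʳ C)) (ℚₚ.*-identityˡ ε))
    where
    instance
      C-nonZero : NonZero C
      C-nonZero = ℚₚ.pos⇒nonZero C {{positive 0<C}}

    0<1/C : 0ℚ < 1/ C
    0<1/C = ℚₚ.positive⁻¹ (1/ C) {{ℚₚ.1/pos⇒pos C {{positive 0<C}}}}

  common-lower-bound : ∀ {a b} → 0ℚ < a → 0ℚ < b → Σ[ c ∈ ℚ ] 0ℚ < c × c ≤ a × c ≤ b
  common-lower-bound {a} {b} 0<a 0<b with ℚₚ.≤-total a b
  ... | inj₁ a≤b = a , 0<a , ℚₚ.≤-refl , a≤b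
  ... | inj₂ b≤a = b , 0<b , b≤a , ℚₚ.≤-refl

  <-+-half : ∀ {a b c ε} → a < b + ε * ½ → b < c + ε * ½ → a < c + ε
  <-+-half {a} {b} {c} {ε} h k = 0<⇒< (+-pos (<⇒0< h) (<⇒0< k))
    (solve 4 (λ a b c e → (b :+ e :* con ½ :- a) :+ (c :+ e :* con ½ :- b) := c :+ e :- a) refl a b c ε)

  -- (u + δ)(v + δ) ≥ 0 bounds u v from below by - δ (u + v + δ).
  *-almost-nonNeg : ∀ {u v A B C ε δ δ′} → 0ℚ < δ → δ ≤ 1ℚ → δ ≤ δ′ → 0ℚ < C →
    A + B + 1ℚ ≡ C → C * δ′ ≡ ε →
    0ℚ < u + δ → 0ℚ < v + δ → u < A → v < B → 0ℚ < u * v + ε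
  *-almost-nonNeg {u} {v} {A} {B} {_} {_} {δ} {δ′} 0<δ δ≤1 δ≤δ′ 0<C refl refl hu hv u<A v<B =
    subst (0ℚ <_)
      (solve 6 (λ u v A B d d′ →
          (((u :+ d) :* (v :+ d) :+ d :* (A :- u)) :+ d :* (B :- v))
            :+ (d :* (con 1ℚ :- d) :+ (A :+ B :+ con 1ℚ) :* (d′ :- d))
          := u :* v :+ (A :+ B :+ con 1ℚ) :* d′) refl u v A B δ δ′)
      (+-pos-nonNeg (+-pos (+-pos (*-pos hu hv) (*-pos 0<δ (<⇒0< u<A))) (*-pos 0<δ (<⇒0< v<B)))
        (+-nonNeg (*-nonNeg (ℚₚ.<⇒≤ 0<δ) (≤⇒0≤ δ≤1)) (*-nonNeg (ℚₚ.<⇒≤ 0<C) (≤⇒0≤ δ≤δ′))))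

  ∣p∣<ε⇒p<ε : ∀ {p ε} → ∣ p ∣ < ε → p < ε
  ∣p∣<ε⇒p<ε {p} = ℚₚ.≤-<-trans (p≤∣p∣ p)

  *≤∣∣* : ∀ a {z ρ} → ∣ z ∣ < ρ → a * z ≤ ∣ a ∣ * ρ
  *≤∣∣* a {z} {ρ} h = ℚₚ.≤-trans (p≤∣p∣ (a * z))
    (subst (_≤ ∣ a ∣ * ρ) (sym (ℚₚ.∣p*q∣≡∣p∣*∣q∣ a z))
      (ℚₚ.*-monoˡ-≤-nonNeg ∣ a ∣ {{ℚₚ.∣-∣-nonNeg a}} (ℚₚ.<⇒≤ h)))

  affine-lipschitz : ∀ a b {ρ} c u v u′ v′ → 0ℚ < ρ → ∣ u - u′ ∣ < ρ → ∣ v - v′ ∣ < ρ →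
    a * u + b * v + c < a * u′ + b * v′ + c + (1ℚ + (∣ a ∣ + ∣ b ∣)) * ρ
  affine-lipschitz a b {ρ} c u v u′ v′ 0<ρ hu hv =
    0<⇒< (+-pos-nonNeg 0<ρ (+-nonNeg (≤⇒0≤ (*≤∣∣* a hu)) (≤⇒0≤ (*≤∣∣* b hv))))
      (solve 10 (λ a b c u v u′ v′ r A B →
          r :+ ((A :* r :- a :* (u :- u′)) :+ (B :* r :- b :* (v :- v′)))
          := a :* u′ :+ b :* v′ :+ c :+ (con 1ℚ :+ (A :+ B)) :* r :- (a :* u :+ b :* v :+ c))
        refl a b c u v u′ v′ ρ ∣ a ∣ ∣ b ∣)

  affine-modulus : ∀ a b {δ} → 0ℚ < δ → Σ[ ρ ∈ ℚ ] 0ℚ < ρ ×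
    (∀ c u v u′ v′ → ∣ u - u′ ∣ < ρ → ∣ v - v′ ∣ < ρ →
      a * u + b * v + c < a * u′ + b * v′ + c + δ)
  affine-modulus a b 0<δ =
    let ρ , 0<ρ , eq = quotient {C = 1ℚ + (∣ a ∣ + ∣ b ∣)} 0<δ
          (+-pos-nonNeg 0<1 (+-nonNeg (ℚₚ.0≤∣p∣ a) (ℚₚ.0≤∣p∣ b)))
    in ρ , 0<ρ , λ c u v u′ v′ hu hv →
      subst (λ z → a * u + b * v + c < a * u′ + b * v′ + c + z) eq
        (affine-lipschitz a b c u v u′ v′ 0<ρ hu hv)

  -- Natural numbers and reciprocals in ℚ

  fromℕ : ℕ → ℚ
  fromℕ zero    = 0ℚ
  fromℕ (suc n) = 1ℚ + fromℕ n

  fromℕ-nonNeg : ∀ n → 0ℚ ≤ fromℕ n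
  fromℕ-nonNeg zero    = ℚₚ.≤-refl
  fromℕ-nonNeg (suc n) = +-nonNeg (ℚₚ.<⇒≤ 0<1) (fromℕ-nonNeg n)

  fromℕ-< : ∀ {m n} → m <ⁿ n → 1ℚ ≤ fromℕ n - fromℕ m
  fromℕ-< {zero}  {suc n} _ = 0≤⇒≤ (fromℕ-nonNeg n)
    (solve 1 (λ n → n := con 1ℚ :+ n :- con 0ℚ :- con 1ℚ) refl (fromℕ n))
  fromℕ-< {suc m} {suc n} (s≤s m<n) = subst (1ℚ ≤_)
    (solve 2 (λ m n → n :- m := con 1ℚ :+ n :- (con 1ℚ :+ m)) refl (fromℕ m) (fromℕ n))
    (fromℕ-< m<n)

  ½<square : ∀ {x} → 1ℚ ≤ x → 0ℚ < x * x - ½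
  ½<square {x} 1≤x = subst (0ℚ <_)
    (solve 1 (λ x → con ½ :+ ((x :- con 1ℚ) :* x :+ (x :- con 1ℚ)) := x :* x :- con ½) refl x)
    (+-pos-nonNeg 0<½ (+-nonNeg (*-nonNeg (≤⇒0≤ 1≤x) (ℚₚ.≤-trans (ℚₚ.<⇒≤ 0<1) 1≤x)) (≤⇒0≤ 1≤x)))

  -- Set to 0 off the positive rationals, so that it applies to every term of a sequence, including
  -- early terms of a positive real that are not yet positive, and is never negative.
  recip : ℚ → ℚ
  recip d with 0ℚ ℚₚ.<? d
  ... | yes 0<d = proj₁ (quotient 0<1 0<d)
  ... | no _    = 0ℚ

  recip-nonNeg : ∀ d → 0ℚ ≤ recip d
  recip-nonNeg d with 0ℚ ℚₚ.<? d
  ... | yes 0<d = ℚₚ.<⇒≤ (proj₁ (proj₂ (quotient 0<1 0<d)))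
  ... | no _    = ℚₚ.≤-refl

  recip-inverseʳ : ∀ {d} → 0ℚ < d → d * recip d ≡ 1ℚ
  recip-inverseʳ {d} 0<d with 0ℚ ℚₚ.<? d
  ... | yes 0<d′ = proj₂ (proj₂ (quotient 0<1 0<d′))
  ... | no 0≮d   = contradiction 0<d 0≮d

  recip-pos : ∀ {d} → 0ℚ < d → 0ℚ < recip d
  recip-pos {d} 0<d with 0ℚ ℚₚ.<? d
  ... | yes 0<d′ = proj₁ (proj₂ (quotient 0<1 0<d′))
  ... | no 0≮d   = contradiction 0<d 0≮d

  recip-difference : ∀ {a b} → 0ℚ < a → 0ℚ < b →
    recip a - recip b ≡ recip a * recip b * (b - a)
  recip-difference {a} {b} 0<a 0<b = sym (trans
    (solve 4 (λ a b r s → r :* s :* (b :- a) := r :* (b :* s) :- (a :* r) :* s) refl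
      a b (recip a) (recip b))
    (cong₂ _-_
      (trans (cong (recip a *_) (recip-inverseʳ 0<b)) (ℚₚ.*-identityʳ (recip a)))
      (trans (cong (_* recip b) (recip-inverseʳ 0<a)) (ℚₚ.*-identityˡ (recip b)))))

  recip-antitone : ∀ {a b} → 0ℚ < a → a < b → recip b ≤ recip a
  recip-antitone {a} {b} 0<a a<b = 0≤⇒≤
    (*-nonNeg (*-nonNeg (recip-nonNeg a) (recip-nonNeg b)) (ℚₚ.<⇒≤ (<⇒0< a<b)))
    (sym (recip-difference 0<a (ℚₚ.<-trans 0<a a<b)))

  -- Beyond ε the slope of 1/x is at most 1/ε². As b - a may be negative, δ/ε² - (b - a)/(ab) is
  -- split into (a + δ - b)/(ab) and (1/ε² - 1/(ab)) δ, the first positive and the second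
  -- nonnegative.
  recip-lipschitz : ∀ {a b ε δ} → 0ℚ < ε → ε < a → ε < b → 0ℚ < δ → b < a + δ →
    recip a < recip b + recip ε * recip ε * δ
  recip-lipschitz {a} {b} {ε} {δ} 0<ε ε<a ε<b 0<δ b<a+δ = 0<⇒<
    (+-pos-nonNeg
      (*-pos (*-pos (recip-pos 0<a) (recip-pos 0<b)) (<⇒0< b<a+δ))
      (*-nonNeg (+-nonNeg (*-nonNeg (recip-nonNeg ε) (≤⇒0≤ (recip-antitone 0<ε ε<a)))
                          (*-nonNeg (recip-nonNeg a) (≤⇒0≤ (recip-antitone 0<ε ε<b))))
                (ℚₚ.<⇒≤ 0<δ)))
    (trans (expand a b (recip a) (recip b) (recip ε) δ)
      (trans (cong (λ z → recip ε * recip ε * δ - z) (sym (recip-difference 0<a 0<b)))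
        (regroup (recip ε * recip ε * δ) (recip a) (recip b))))
    where
    0<a : 0ℚ < a
    0<a = ℚₚ.<-trans 0<ε ε<a
    0<b : 0ℚ < b
    0<b = ℚₚ.<-trans 0<ε ε<b
    expand : ∀ a b r s K d →
      r * s * (a + d - b) + (K * (K - r) + r * (K - s)) * d ≡ K * K * d - r * s * (b - a)
    expand = solve 6 (λ a b r s K d →
      r :* s :* (a :+ d :- b) :+ (K :* (K :- r) :+ r :* (K :- s)) :* d
      := K :* K :* d :- r :* s :* (b :- a)) refl
    regroup : ∀ e r s → e - (r - s) ≡ s + e - r
    regroup = solve 3 (λ e r s → e :- (r :- s) := s :+ e :- r) refl

  recip-modulus : ∀ {ε η} → 0ℚ < ε → 0ℚ < η → Σ[ δ ∈ ℚ ] 0ℚ < δ ×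
    (∀ a b → ε < a → ε < b → b < a + δ → recip a < recip b + η)
  recip-modulus {ε} 0<ε 0<η =
    let δ , 0<δ , eq = quotient {C = recip ε * recip ε} 0<η (*-pos (recip-pos 0<ε) (recip-pos 0<ε))
    in δ , 0<δ , λ a b ε<a ε<b b<a+δ →
      subst (λ z → recip a < recip b + z) eq (recip-lipschitz 0<ε ε<a ε<b 0<δ b<a+δ)

-- The order of ℝ

open import Defs

Eventually : (ℕ → Set) → Set
Eventually P = ∃[ N ] (∀ n → N ≤ⁿ n → P n)

module _ {P Q R : ℕ → Set} where
  eventually-zip : (∀ n → P n → Q n → R n) → Eventually P → Eventually Q → Eventually R
  eventually-zip f (M , p) (N , q) = M ⊔ N , λ n h →
    f n (p n (ℕₚ.m⊔n≤o⇒m≤o M N h)) (q n (ℕₚ.m⊔n≤o⇒n≤o M N h))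

module _ {P Q : ℕ → Set} where
  eventually-map : (∀ n → P n → Q n) → Eventually P → Eventually Q
  eventually-map f (N , p) = N , λ n h → f n (p n h)

  eventually-disjoint : (∀ n → P n → ¬ Q n) → Eventually P → ¬ Eventually Q
  eventually-disjoint f p q with eventually-zip (λ n a b → f n a b) p q
  ... | N , h = h N ℕₚ.≤-refl

infix 4 _≲_

-- `≤` is a negation and carries no data. This equivalent form yields an index for each ε, as
-- termwise arithmetic requires.
_≲_ : ℝ → ℝ → Set
x ≲ y = ∀ ε → 0ℚ ℚ.< ε → Eventually (λ n → seq x n ℚ.< seq y n ℚ.+ ε)

≲⇒≤ : ∀ {x y} → x ≲ y → x ≤ y
≲⇒≤ {x} {y} x≲y (ε , 0<ε , y<x) =
  eventually-disjoint (λ n h k → ℚₚ.<-asym h k) (x≲y ε 0<ε) y<x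

-- One rational decides: the term of x - y at an index N past which its terms differ by less than
-- ε/4. Below ε/2, it keeps x - y under ε from N on; otherwise it keeps x above y + ε/4, against x ≤
-- y.
≤⇒≲ : ∀ {x y} → x ≤ y → x ≲ y
≤⇒≲ {x} {y} x≤y ε 0<ε with cauchy (x - y) (ε ℚ.* ½ ℚ.* ½) (half-pos (half-pos 0<ε))
... | N , close with (seq x N ℚ.- seq y N) ℚₚ.<? ε ℚ.* ½
... | yes small = N , λ n N≤n →
  0<⇒< (+-pos (+-pos (<⇒0< (∣-∣<⇒< {a = seq x n ℚ.- seq y n} {seq x N ℚ.- seq y N}
                              (close n N N≤n ℕₚ.≤-refl)))
                     (<⇒0< small))
              (half-pos (half-pos 0<ε)))
    (solve 4 (λ a b z e →
        ((z :+ e :* con ½ :* con ½ :- (a :- b)) :+ (e :* con ½ :- z)) :+ e :* con ½ :* con ½ := b :+ e :- a)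
      refl (seq x n) (seq y n) (seq x N ℚ.- seq y N) ε)
... | no large = contradiction
  (ε ℚ.* ½ ℚ.* ½ , half-pos (half-pos 0<ε) , N , λ n N≤n →
    0<⇒< (+-pos-nonNeg (<⇒0< (∣-∣<⇒< {a = seq x N ℚ.- seq y N} {seq x n ℚ.- seq y n}
                                (close N n ℕₚ.≤-refl N≤n)))
                       (≤⇒0≤ (ℚₚ.≮⇒≥ large)))
      (solve 4 (λ a b z e →
          ((a :- b) :+ e :* con ½ :* con ½ :- z) :+ (z :- e :* con ½) := a :- (b :+ e :* con ½ :* con ½))
        refl (seq x n) (seq y n) (seq x N ℚ.- seq y N) ε))
  x≤y

≤-trans : ∀ {x y z} → x ≤ y → y ≤ z → x ≤ z
≤-trans {x} {y} {z} x≤y y≤z = ≲⇒≤ {x} {z} λ ε 0<ε →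
  eventually-zip (λ n → <-+-half {seq x n} {seq y n} {seq z n} {ε})
    (≤⇒≲ {x} {y} x≤y (ε ℚ.* ½) (half-pos 0<ε)) (≤⇒≲ {y} {z} y≤z (ε ℚ.* ½) (half-pos 0<ε))

≃-sym : ∀ {x y} → x ≃ y → y ≃ x
≃-sym {x} {y} x≃y ε 0<ε =
  eventually-map (λ n → subst (ℚ._< ε) (∣p-q∣≡∣q-p∣ (seq x n) (seq y n))) (x≃y ε 0<ε)

≃⇒≤ : ∀ {x y} → x ≃ y → x ≤ y
≃⇒≤ {x} {y} x≃y = ≲⇒≤ {x} {y} λ ε 0<ε → eventually-map (λ n → ∣-∣<⇒<) (x≃y ε 0<ε)

≤-antisym : ∀ {x y} → x ≤ y → y ≤ x → x ≃ y
≤-antisym {x} {y} x≤y y≤x ε 0<ε =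
  eventually-zip (λ n → <⇒∣-∣<) (≤⇒≲ {x} {y} x≤y ε 0<ε) (≤⇒≲ {y} {x} y≤x ε 0<ε)

<⇒≤ : ∀ {x y} → x < y → x ≤ y
<⇒≤ (ε , 0<ε , x<y) (δ , 0<δ , y<x) = eventually-disjoint
  (λ n h k → ℚₚ.<-asym (add h 0<ε) (add k 0<δ)) x<y y<x
  where
  add : ∀ {a b ε} → a ℚ.+ ε ℚ.< b → 0ℚ ℚ.< ε → a ℚ.< b
  add {a} {b} {ε} h 0<ε = 0<⇒< (+-pos (<⇒0< h) 0<ε)
    (solve 3 (λ a b e → (b :- (a :+ e)) :+ e := b :- a) refl a b ε)

≤-total : ∀ x y → ¬ ¬ (x ≤ y ⊎ y ≤ x)
≤-total x y ¬total = ¬total (inj₁ λ y<x → ¬total (inj₂ (<⇒≤ {y} {x} y<x)))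

eventually-≡⇒≃ : ∀ {x y} → Eventually (λ n → seq x n ≡ seq y n) → x ≃ y
eventually-≡⇒≃ {x} {y} eq ε 0<ε = eventually-map
  (λ n h → subst (λ z → ℚ.∣ seq x n ℚ.- z ∣ ℚ.< ε) h
    (subst (ℚ._< ε) (cong ℚ.∣_∣ (sym (ℚₚ.+-inverseʳ (seq x n)))) 0<ε)) eq

≡⇒≃ : ∀ {x y} → (∀ n → seq x n ≡ seq y n) → x ≃ y
≡⇒≃ {x} {y} eq = eventually-≡⇒≃ {x} {y} (0 , λ n _ → eq n)

≃-refl : ∀ {x} → x ≃ x
≃-refl {x} = ≡⇒≃ {x} {x} λ n → refl

≤-refl : ∀ {x} → x ≤ x
≤-refl {x} = ≃⇒≤ {x} {x} (≃-refl {x})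

-- Rational constants and the compatibility of the order with + and *

const : ℚ → ℝ
const q = mkℝ (λ _ → q) (const-cauchy q)

const-≤ : ∀ {p q} → p ℚ.≤ q → const p ≤ const q
const-≤ {p} {q} p≤q (ε , 0<ε , N , q<p) = ℚₚ.<-irrefl refl (ℚₚ.<-≤-trans
  (0<⇒< (+-pos (<⇒0< (q<p N ℕₚ.≤-refl)) 0<ε)
    (solve 3 (λ p q e → (p :- (q :+ e)) :+ e := p :- q) refl p q ε)) p≤q)

const-< : ∀ {p q} → p ℚ.< q → const p < const q
const-< {p} {q} p<q = (q ℚ.- p) ℚ.* ½ , half-pos (<⇒0< p<q) , 0 , λ n _ →
  0<⇒< (half-pos (<⇒0< p<q))
    (solve 2 (λ p q → (q :- p) :* con ½ := q :- (p :+ (q :- p) :* con ½)) refl p q)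

0≤⇒≤ᴿ : ∀ {x y} → 0ℝ ≤ y - x → x ≤ y
0≤⇒≤ᴿ {x} {y} h = ≲⇒≤ {x} {y} λ ε 0<ε → eventually-map
  (λ n k → 0<⇒< (<⇒0< k)
    (solve 3 (λ a b e → b :- a :+ e :- con 0ℚ := b :+ e :- a) refl (seq x n) (seq y n) ε))
  (≤⇒≲ {0ℝ} {y - x} h ε 0<ε)

≤⇒0≤ᴿ : ∀ {x y} → x ≤ y → 0ℝ ≤ y - x
≤⇒0≤ᴿ {x} {y} h = ≲⇒≤ {0ℝ} {y - x} λ ε 0<ε → eventually-map
  (λ n k → 0<⇒< (<⇒0< k)
    (solve 3 (λ a b e → b :+ e :- a := b :- a :+ e :- con 0ℚ) refl (seq x n) (seq y n) ε))
  (≤⇒≲ {x} {y} h ε 0<ε)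

0≤+ : ∀ {x y} → 0ℝ ≤ x → 0ℝ ≤ y → 0ℝ ≤ x + y
0≤+ {x} {y} 0≤x 0≤y = ≲⇒≤ {0ℝ} {x + y} λ ε 0<ε → eventually-zip
  (λ n h k → 0<⇒< (+-pos (<⇒0< h) (<⇒0< k))
    (solve 3 (λ a b e → (a :+ e :* con ½ :- con 0ℚ) :+ (b :+ e :* con ½ :- con 0ℚ) := a :+ b :+ e :- con 0ℚ)
      refl (seq x n) (seq y n) ε))
  (≤⇒≲ {0ℝ} {x} 0≤x (ε ℚ.* ½) (half-pos 0<ε)) (≤⇒≲ {0ℝ} {y} 0≤y (ε ℚ.* ½) (half-pos 0<ε))

0≤* : ∀ {x y} → 0ℝ ≤ x → 0ℝ ≤ y → 0ℝ ≤ x * y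
0≤* {x} {y} 0≤x 0≤y = ≲⇒≤ {0ℝ} {x * y} λ ε 0<ε →
  let A , 0<A , xA = cauchy⇒bounded (seq x) (cauchy x)
      B , 0<B , yB = cauchy⇒bounded (seq y) (cauchy y)
      0<C = +-pos (+-pos 0<A 0<B) 0<1
      δ′ , 0<δ′ , Cδ′≡ε = quotient 0<ε 0<C
      -- The product falls below 0 by at most δ (A + B + δ); δ ≤ 1 bounds this by C δ, and δ ≤ δ′ by
      -- ε.
      δ , 0<δ , δ≤1 , δ≤δ′ = common-lower-bound 0<1 0<δ′
  in eventually-zip (λ n (h , k) (h′ , k′) →
       *-almost-nonNeg 0<δ δ≤1 δ≤δ′ 0<C refl Cδ′≡ε h h′ (∣p∣<ε⇒p<ε k) (∣p∣<ε⇒p<ε k′))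
     (eventually-zip (λ n → _,_) (≤⇒≲ {0ℝ} {x} 0≤x δ 0<δ) xA)
     (eventually-zip (λ n → _,_) (≤⇒≲ {0ℝ} {y} 0≤y δ 0<δ) yB)

≤-respʳ-≡ : ∀ {x y z} → x ≤ y → (∀ n → seq y n ≡ seq z n) → x ≤ z
≤-respʳ-≡ {x} {y} {z} x≤y eq = ≤-trans {x} {y} {z} x≤y (≃⇒≤ {y} {z} (≡⇒≃ {y} {z} eq))

convex-nonNeg : ∀ {x y t} → 0ℝ ≤ x → 0ℝ ≤ y → 0ℝ ≤ t → t ≤ 1ℝ → 0ℝ ≤ (1ℝ - t) * x + t * y
convex-nonNeg {x} {y} {t} 0≤x 0≤y 0≤t t≤1 =
  0≤+ {(1ℝ - t) * x} {t * y} (0≤* {1ℝ - t} {x} (≤⇒0≤ᴿ {t} {1ℝ} t≤1) 0≤x) (0≤* {t} {y} 0≤t 0≤y)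

below-gap : ∀ {x ε δ} → Eventually (λ n → 0ℚ ℚ.+ ε ℚ.< seq x n) → δ ℚ.≤ ε → 0ℝ ≤ x - const δ
below-gap {x} {ε} {δ} h δ≤ε = ≲⇒≤ {0ℝ} {x - const δ} λ η 0<η → eventually-map
  (λ n k → 0<⇒< (+-pos-nonNeg (+-pos 0<η (<⇒0< k)) (≤⇒0≤ δ≤ε))
    (solve 4 (λ x e d h → h :+ (x :- (con 0ℚ :+ e)) :+ (e :- d) := x :- d :+ h :- con 0ℚ)
      refl (seq x n) ε δ η)) h

gap⇒0< : ∀ {x ε} → 0ℚ ℚ.< ε → 0ℝ ≤ x - const ε → 0ℝ < x
gap⇒0< {x} {ε} 0<ε h = ε ℚ.* ½ , half-pos 0<ε , eventually-map
  (λ n k → 0<⇒< (<⇒0< k)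
    (solve 2 (λ x e → x :- e :+ e :* con ½ :- con 0ℚ := x :- (con 0ℚ :+ e :* con ½))
      refl (seq x n) ε))
  (≤⇒≲ {0ℝ} {x - const ε} h (ε ℚ.* ½) (half-pos 0<ε))

-- Let δ be the smaller of the two rational gaps. The weights sum to 1, so subtracting δ from x and
-- y subtracts δ from the combination, and the nonnegative case applies. It is never decided which
-- weight is positive.
convex-pos : ∀ {x y t} → 0ℝ < x → 0ℝ < y → 0ℝ ≤ t → t ≤ 1ℝ → 0ℝ < (1ℝ - t) * x + t * y
convex-pos {x} {y} {t} (ε , 0<ε , ε<x) (ε′ , 0<ε′ , ε′<y) 0≤t t≤1 =
  let δ , 0<δ , δ≤ε , δ≤ε′ = common-lower-bound 0<ε 0<ε′
      x-δ = x - const δ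
      y-δ = y - const δ
      z = (1ℝ - t) * x + t * y
  in gap⇒0< {z} 0<δ (≤-respʳ-≡ {0ℝ} {(1ℝ - t) * x-δ + t * y-δ} {z - const δ}
       (convex-nonNeg {x-δ} {y-δ} {t} (below-gap {x} ε<x δ≤ε) (below-gap {y} ε′<y δ≤ε′) 0≤t t≤1)
       λ n → solve 4 (λ x y t d → (con 1ℚ :- t) :* (x :- d) :+ t :* (y :- d)
                                    := (con 1ℚ :- t) :* x :+ t :* y :- d)
               refl (seq x n) (seq y n) (seq t n) δ)

-- Reciprocals and interpolation in ℝ

reciprocal : ∀ x → 0ℝ < x → ℝ
reciprocal x (ε , 0<ε , N , ε<x) = mkℝ (λ n → recip (seq x n)) cauchy′
  where
  close : ∀ {η} → 0ℚ ℚ.< η → ∃[ L ] (∀ m n → L ≤ⁿ m → L ≤ⁿ n →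
    recip (seq x m) ℚ.< recip (seq x n) ℚ.+ η)
  close 0<η =
    let δ , 0<δ , bound = recip-modulus 0<ε 0<η
        M , h = cauchy x δ 0<δ
        lower : ∀ n → N ⊔ M ≤ⁿ n → ε ℚ.< seq x n
        lower n L≤n = subst (ℚ._< seq x n) (ℚₚ.+-identityˡ ε) (ε<x n (ℕₚ.m⊔n≤o⇒m≤o N M L≤n))
    in N ⊔ M , λ m n L≤m L≤n → bound (seq x m) (seq x n) (lower m L≤m) (lower n L≤n)
         (∣-∣<⇒< (h n m (ℕₚ.m⊔n≤o⇒n≤o N M L≤n) (ℕₚ.m⊔n≤o⇒n≤o N M L≤m)))
  cauchy′ : IsCauchy (λ n → recip (seq x n))
  cauchy′ η 0<η =
    let L , h = close 0<η
    in L , λ m n L≤m L≤n → <⇒∣-∣< (h m n L≤m L≤n) (h n m L≤n L≤m)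

reciprocal-nonNeg : ∀ x 0<x → 0ℝ ≤ reciprocal x 0<x
reciprocal-nonNeg x 0<x = ≲⇒≤ {0ℝ} {reciprocal x 0<x} λ ε 0<ε →
  0 , λ n _ → subst (0ℚ ℚ.<_) (ℚₚ.+-comm ε _) (+-pos-nonNeg 0<ε (recip-nonNeg (seq x n)))

-- Past the gap the equation holds term by term, not just in the limit, which reduces the identities
-- of `interpolate` to ring identities in ℚ.
reciprocal-inverse : ∀ x 0<x → Eventually (λ n → seq x n ℚ.* seq (reciprocal x 0<x) n ≡ 1ℚ)
reciprocal-inverse x (ε , 0<ε , ε<x) = eventually-map
  (λ n h → recip-inverseʳ (ℚₚ.<-trans 0<ε (subst (ℚ._< seq x n) (ℚₚ.+-identityˡ ε) h))) ε<x

-- t = (y - x) / (z - x).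
interpolate : ∀ {x y z} → x ≤ y → y ≤ z → x < z →
  ∃[ t ] (0ℝ ≤ t × t ≤ 1ℝ × ((1ℝ - t) * x + t * z) ≃ y)
interpolate {x} {y} {z} x≤y y≤z (ε , 0<ε , x<z) = t ,
  0≤* {y - x} {r} (≤⇒0≤ᴿ {x} {y} x≤y) 0≤r ,
  0≤⇒≤ᴿ {t} {1ℝ} (≤-trans {0ℝ} {(z - y) * r} {1ℝ - t}
    (0≤* {z - y} {r} (≤⇒0≤ᴿ {y} {z} y≤z) 0≤r)
    (≃⇒≤ {(z - y) * r} {1ℝ - t} (eventually-≡⇒≃ {(z - y) * r} {1ℝ - t}
      (eventually-map (λ n → complement (seq x n) (seq y n) (seq z n) (seq r n)) inverse)))) ,
  eventually-≡⇒≃ {(1ℝ - t) * x + t * z} {y}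
    (eventually-map (λ n → combination (seq x n) (seq y n) (seq z n) (seq r n)) inverse)
  where
  0<z-x : 0ℝ < z - x
  0<z-x = ε , 0<ε , eventually-map
    (λ n h → 0<⇒< (<⇒0< h)
      (solve 3 (λ x z e → z :- (x :+ e) := z :- x :- (con 0ℚ :+ e)) refl (seq x n) (seq z n) ε)) x<z
  r t : ℝ
  r = reciprocal (z - x) 0<z-x
  t = (y - x) * r
  0≤r : 0ℝ ≤ r
  0≤r = reciprocal-nonNeg (z - x) 0<z-x
  inverse : Eventually (λ n → (seq z n ℚ.- seq x n) ℚ.* seq r n ≡ 1ℚ)
  inverse = reciprocal-inverse (z - x) 0<z-x
  complement : ∀ x y z r → (z ℚ.- x) ℚ.* r ≡ 1ℚ → (z ℚ.- y) ℚ.* r ≡ 1ℚ ℚ.- (y ℚ.- x) ℚ.* r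
  complement x y z r h = trans
    (solve 4 (λ x y z r → (z :- y) :* r := (z :- x) :* r :- (y :- x) :* r) refl x y z r)
    (cong (ℚ._- (y ℚ.- x) ℚ.* r) h)
  combination : ∀ x y z r → (z ℚ.- x) ℚ.* r ≡ 1ℚ →
    (1ℚ ℚ.- (y ℚ.- x) ℚ.* r) ℚ.* x ℚ.+ (y ℚ.- x) ℚ.* r ℚ.* z ≡ y
  combination x y z r h = trans
    (solve 4 (λ x y z r → (con 1ℚ :- (y :- x) :* r) :* x :+ (y :- x) :* r :* z
                            := x :+ (y :- x) :* ((z :- x) :* r)) refl x y z r)
    (trans (cong (λ w → x ℚ.+ (y ℚ.- x) ℚ.* w) h)
      (solve 2 (λ x y → x :+ (y :- x) :* con 1ℚ := y) refl x y))

-- Lower bounds for the dimension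

open Equivalence using (to; from)

-- Double-negation shift, valid by induction because the index set is finite. It allows finitely
-- many undecidable choices at once.
¬¬-finite : ∀ {n} {P : Fin n → Set} → (∀ i → ¬ ¬ P i) → ¬ ¬ (∀ i → P i)
¬¬-finite {zero}  h k = k λ ()
¬¬-finite {suc n} h k = h zero λ p₀ → ¬¬-finite (λ i → h (suc i)) λ p →
  k λ { zero → p₀ ; (suc i) → p i }

-- With its converse below, this turns membership in `𝓕 n` into a closure condition that matches a
-- statement about pairwise intersections of sets.
pair-generates⇒𝓕 : ∀ {n} (σ : Subset n) → (∀ {i j} → i ∈ σ → j ∈ σ → i ≢ j → ∀ k → k ∈ σ) → 𝓕 n σ
pair-generates⇒𝓕 {n} σ h with Finₚ.any? (_∈? σ)
... | no empty = inj₂ (inj₂ (Empty-unique empty))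
... | yes (i , i∈σ) with Finₚ.any? (λ j → (j ∈? σ) ×-dec ¬? (i Finₚ.≟ j))
...   | yes (j , j∈σ , i≢j) = inj₁ (⊆-antisym ⊆⊤ λ {k} _ → h i∈σ j∈σ i≢j k)
...   | no alone = inj₂ (inj₁ (i , ⊆-antisym
        (λ {j} j∈σ → subst (_∈ ⁅ i ⁆)
          (decidable-stable (i Finₚ.≟ j) λ i≢j → alone (j , j∈σ , i≢j)) (x∈⁅x⁆ i))
        (λ j∈⁅i⁆ → subst (_∈ σ) (sym (x∈⁅y⁆⇒x≡y i j∈⁅i⁆)) i∈σ)))

𝓕⇒pair-generates : ∀ {n} {σ : Subset n} {i j} → 𝓕 n σ → i ∈ σ → j ∈ σ → i ≢ j → ∀ k → k ∈ σ
𝓕⇒pair-generates (inj₁ refl) _ _ _ _ = ∈⊤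
𝓕⇒pair-generates (inj₂ (inj₁ (l , refl))) i∈ j∈ i≢j _ =
  contradiction (trans (x∈⁅y⁆⇒x≡y l i∈) (sym (x∈⁅y⁆⇒x≡y l j∈))) i≢j
𝓕⇒pair-generates (inj₂ (inj₂ refl)) i∈ _ _ _ = contradiction i∈ ∉⊥

module _ {n d} {𝓤 : Vector (Region d) n} where

  realizes-𝓕 :
    (∀ {i j p} → i ≢ j → p ∈ᴿ 𝓤 i → p ∈ᴿ 𝓤 j → ∀ k → p ∈ᴿ 𝓤 k) →
    ∃[ p ] (∀ i → p ∈ᴿ 𝓤 i) →
    (∀ i → ∃[ p ] (p ∈ᴿ 𝓤 i × (∀ j → i ≢ j → ¬ p ∈ᴿ 𝓤 j))) →
    ∃[ p ] (∀ i → ¬ p ∈ᴿ 𝓤 i) →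
    code 𝓤 ≐ 𝓕 n
  realizes-𝓕 meet (o , o∈) private-point (e , e∉) = sound , complete
    where
    sound : ∀ {σ} → code 𝓤 σ → 𝓕 n σ
    sound {σ} (p , p⇔) = pair-generates⇒𝓕 σ λ {i} {j} i∈ j∈ i≢j k →
      to (p⇔ k) (meet i≢j (from (p⇔ i) i∈) (from (p⇔ j) j∈) k)
    complete : ∀ {σ} → 𝓕 n σ → code 𝓤 σ
    complete (inj₁ refl) = o , λ i → mk⇔ (λ _ → ∈⊤) (λ _ → o∈ i)
    complete (inj₂ (inj₂ refl)) = e , λ i → mk⇔ (λ h → contradiction h (e∉ i)) (λ h → contradiction h ∉⊥)
    complete (inj₂ (inj₁ (i , refl))) with private-point i
    ... | p , p∈ , p∉ = p , λ j → mk⇔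
      (λ h → subst (_∈ ⁅ i ⁆) (decidable-stable (i Finₚ.≟ j) λ i≢j → p∉ j i≢j h) (x∈⁅x⁆ i))
      (λ h → subst (λ k → p ∈ᴿ 𝓤 k) (sym (x∈⁅y⁆⇒x≡y i h)) p∈)

  -- A subset is a vector of bits, so writing down σ takes a decision of membership for every i;
  -- these are available only under double negation.
  codeword-of-point : ∀ p → ¬ ¬ (∃[ σ ] (∀ i → p ∈ᴿ 𝓤 i ⇔ i ∈ σ))
  codeword-of-point p k = ¬¬-finite {P = λ i → Dec (p ∈ᴿ 𝓤 i)} (λ i → ¬¬-excluded-middle) λ dec →
    k (tabulate (λ i → does (dec i)) , λ i → mk⇔
      (λ h → lookup⇒[]= i _ (trans (lookup∘tabulate _ i) (dec-true (dec i) h)))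
      (λ h → does-true (dec i) (trans (sym (lookup∘tabulate _ i)) ([]=⇒lookup h))))
    where
    does-true : ∀ {A : Set} (a? : Dec A) → does a? ≡ true → A
    does-true (yes a) _ = a

  meet-𝓕 : code 𝓤 ≐ 𝓕 n → ∀ {i j p} → i ≢ j → p ∈ᴿ 𝓤 i → p ∈ᴿ 𝓤 j → ∀ k → ¬ ¬ p ∈ᴿ 𝓤 k
  meet-𝓕 (sound , _) {i} {j} {p} i≢j pi pj k p∉ = codeword-of-point p λ (σ , p⇔) →
    p∉ (from (p⇔ k) (𝓕⇒pair-generates (sound (p , p⇔)) (to (p⇔ i) pi) (to (p⇔ j) pj) i≢j k))

-- Coordinate directions and the bound n ≤ 2 d

infixl 5 _[_]≔_

_[_]≔_ : ∀ {d} → ℝ^ d → Fin d → ℝ → ℝ^ d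
p [ k ]≔ s = updateAt p k (always s)

Between : ℝ → ℝ → ℝ → Set
Between x s y = (x ≤ s × s ≤ y) ⊎ (y ≤ s × s ≤ x)

between-self : ∀ {x s y} → Between x s y → Between x s s
between-self {s = s} (inj₁ (x≤s , _)) = inj₁ (x≤s , ≤-refl {s})
between-self {s = s} (inj₂ (_ , s≤x)) = inj₂ (≤-refl {s} , s≤x)

-- The consequences of being a product of intervals on which the lower bound
-- for the dimension rests; convex sets in ℝ⁰ and ℝ¹ have them as well.
record BoxLike {d} (U : Region d) : Set where
  field
    star : ∀ {o x s} k → o ∈ᴿ U → x ∈ᴿ U → Between (o k) s (x k) → ¬ ¬ (o [ k ]≔ s) ∈ᴿ U
    span : ∀ {o x} → o ∈ᴿ U → (∀ k → ¬ ¬ (o [ k ]≔ x k) ∈ᴿ U) → ¬ ¬ x ∈ᴿ U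

open BoxLike

side : Fin 2 → ℝ → ℝ → Set
side zero    o x = x ≤ o
side (suc _) o x = o ≤ x

-- Seen from a common point o, a private point x i of U i escapes some U j
-- along a coordinate direction ± k.  Two indices cannot share a direction,
-- since the one of the two points that is nearer to o in that direction would
-- yield a point of U i ∩ U i′ outside U j.
module _ {m d} {𝓤 : Vector (Region d) (suc (suc m))} (box : ∀ i → BoxLike (𝓤 i))
         (realizes : code 𝓤 ≐ 𝓕 (suc (suc m))) where
  private
    n : ℕ
    n = suc (suc m)

    common : ∃[ p ] (∀ i → p ∈ᴿ 𝓤 i)
    common = map₂ (λ p⇔ i → from (p⇔ i) ∈⊤) (proj₂ realizes (inj₁ refl))

    o : ℝ^ d
    o = proj₁ common

    o∈ : ∀ i → o ∈ᴿ 𝓤 i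
    o∈ = proj₂ common

    private-point : ∀ i → ∃[ p ] (p ∈ᴿ 𝓤 i × (∀ j → j ≢ i → ¬ p ∈ᴿ 𝓤 j))
    private-point i with proj₂ realizes (inj₂ (inj₁ (i , refl)))
    ... | p , p⇔ = p , from (p⇔ i) (x∈⁅x⁆ i) , λ j j≢i h → j≢i (x∈⁅y⁆⇒x≡y i (to (p⇔ j) h))

    x : Fin n → ℝ^ d
    x i = proj₁ (private-point i)

    x∈ : ∀ i → x i ∈ᴿ 𝓤 i
    x∈ i = proj₁ (proj₂ (private-point i))

    y : Fin n → Fin d → ℝ^ d
    y i k = o [ k ]≔ x i k

    Escapes : Fin n → Fin d → Fin 2 → Set
    Escapes i k s = ∃[ j ] (¬ y i k ∈ᴿ 𝓤 j) × side s (o k) (x i k)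

    -- Fix some j ≠ i, which exists because n ≥ 2. If every `y i k` were in U j, then `span` would
    -- put `x i` there, although `x i` is private to U i.
    escape : ∀ i → ¬ ¬ (Σ[ k ∈ Fin d ] Σ[ s ∈ Fin 2 ] Escapes i k s)
    escape i none = span (box j) (o∈ j)
      (λ k yk∉ → ≤-total (x i k) (o k) λ
        { (inj₁ x≤o) → none (k , zero , j , yk∉ , x≤o)
        ; (inj₂ o≤x) → none (k , suc zero , j , yk∉ , o≤x) })
      (proj₂ (proj₂ (private-point i)) j (Finₚ.punchInᵢ≢i i zero))
      where
      j : Fin n
      j = punchIn i zero

    no-nearer : ∀ {i i′ j k} → i ≢ i′ → ¬ y i k ∈ᴿ 𝓤 j → ¬ Between (o k) (x i k) (x i′ k)
    no-nearer {i} {i′} {j} {k} i≢i′ y∉ between =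
      -- The contradictory point is `y i k`: its changed coordinate is that of `x i`, and it also
      -- lies between those of `o` and `x i′`.
      star (box i) k (o∈ i) (x∈ i) (between-self {o k} {x i k} {x i′ k} between) λ y∈ →
      star (box i′) k (o∈ i′) (x∈ i′) between λ y∈′ →
      meet-𝓕 {𝓤 = 𝓤} realizes i≢i′ y∈ y∈′ j y∉

    distinct : ∀ {i i′ k s} → i ≢ i′ → Escapes i k s → ¬ Escapes i′ k s
    distinct {i} {i′} {k} {zero} i≢i′ (_ , y∉ , x≤o) (_ , y′∉ , x′≤o) =
      ≤-total (x i k) (x i′ k) λ
        { (inj₁ x≤x′) → no-nearer (≢-sym i≢i′) y′∉ (inj₂ (x≤x′ , x′≤o))
        ; (inj₂ x′≤x) → no-nearer i≢i′ y∉ (inj₂ (x′≤x , x≤o)) }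
    distinct {i} {i′} {k} {suc _} i≢i′ (_ , y∉ , o≤x) (_ , y′∉ , o≤x′) =
      ≤-total (x i k) (x i′ k) λ
        { (inj₁ x≤x′) → no-nearer i≢i′ y∉ (inj₁ (o≤x , x≤x′))
        ; (inj₂ x′≤x) → no-nearer (≢-sym i≢i′) y′∉ (inj₁ (o≤x′ , x′≤x)) }

  -- Pigeonhole: `combine` packs coordinate and sign into one of 2 d values, and `distinct` makes
  -- this encoding injective. Decidability of the goal permits the choice of all directions under ¬
  -- ¬.
  dimension-bound : n ≤ⁿ d *ⁿ 2
  dimension-bound = decidable-stable (n ℕₚ.≤? d *ⁿ 2) λ n≰ → ¬¬-finite escape λ e →
    n≰ (Finₚ.injective⇒≤ {f = λ i → combine (proj₁ (e i)) (proj₁ (proj₂ (e i)))} λ {i} {i′} eq →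
      decidable-stable (i Finₚ.≟ i′) λ i≢i′ →
        let k≡ , s≡ = Finₚ.combine-injective (proj₁ (e i)) _ (proj₁ (e i′)) _ eq
        in distinct i≢i′ (proj₂ (proj₂ (e i)))
             (subst₂ (Escapes i′) (sym k≡) (sym s≡) (proj₂ (proj₂ (e i′)))))

box⇒boxLike : ∀ {d} {U : Region d} → Box U → BoxLike U
box⇒boxLike (inj₁ empty) = record
  { star = λ {o} k o∈ → contradiction o∈ (empty o)
  ; span = λ {o} o∈ → contradiction o∈ (empty o) }
box⇒boxLike {d} {U} (inj₂ (a , b , _ , U⊆ , ⊆U)) = record
  { star = λ {o} {x} {s} k o∈ x∈ between ¬∈ → ¬∈ (⊆U λ l →
      case l Finₚ.≟ k of λ
        { (yes refl) → subst (λ z → a k ≤ z × z ≤ b k) (sym (updateAt-updates k o))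
            (clamp {a k} {b k} {o k} {s} {x k} (U⊆ o∈ k) (U⊆ x∈ k) between)
        ; (no l≢k) → subst (λ z → a l ≤ z × z ≤ b l) (sym (updateAt-minimal l k o l≢k)) (U⊆ o∈ l) })
  ; span = λ {o} {x} o∈ h ¬∈ → ¬∈ (⊆U λ k →
      -- Each bound on `x k` is itself a negation, so the doubly negated membership may be used.
      (λ lt → h k λ ∈U → subst (a k ≤_) (updateAt-updates k o) (proj₁ (U⊆ ∈U k)) lt) ,
      (λ lt → h k λ ∈U → subst (_≤ b k) (updateAt-updates k o) (proj₂ (U⊆ ∈U k)) lt)) }
  where
  clamp : ∀ {a b o s x} → a ≤ o × o ≤ b → a ≤ x × x ≤ b → Between o s x → a ≤ s × s ≤ b
  clamp {a} {b} {o} {s} {x} (a≤o , o≤b) (a≤x , x≤b) (inj₁ (o≤s , s≤x)) =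
    ≤-trans {a} {o} {s} a≤o o≤s , ≤-trans {s} {x} {b} s≤x x≤b
  clamp {a} {b} {o} {s} {x} (a≤o , o≤b) (a≤x , x≤b) (inj₂ (x≤s , s≤o)) =
    ≤-trans {a} {x} {s} a≤x x≤s , ≤-trans {s} {o} {b} s≤o o≤b

-- Convex sets in dimension at most one

convex⇒boxLike⁰ : ∀ {U : Region 0} → Convex U → BoxLike U
convex⇒boxLike⁰ {U} _ = record
  { star = λ ()
  ; span = λ o∈ _ ¬∈ → ¬∈ (respect U (λ ()) o∈) }

module _ {U : Region 1} (convex : Convex U) where
  -- Interpolation divides by q - p and so needs a strict gap, which cannot be decided. If r is
  -- outside U, a gap is impossible; then q ≤ p, so r coincides with p, and `respect` puts it in U.
  segment : ∀ p q r → p ∈ᴿ U → q ∈ᴿ U → p zero ≤ r zero → r zero ≤ q zero → ¬ ¬ r ∈ᴿ U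
  segment p q r p∈ q∈ p≤r r≤q r∉ = r∉ (respect U {p} {r} (λ { zero → p≃r }) p∈)
    where
    q≤p : q zero ≤ p zero
    q≤p p<q = let t , 0≤t , t≤1 , eq = interpolate {p zero} {r zero} {q zero} p≤r r≤q p<q in
      r∉ (respect U {λ k → (1ℝ - t) * p k + t * q k} {r} (λ { zero → eq }) (convex p q t p∈ q∈ 0≤t t≤1))
    p≃r : p zero ≃ r zero
    p≃r = ≤-antisym {p zero} {r zero} p≤r (≤-trans {r zero} {q zero} {p zero} r≤q q≤p)

  convex⇒boxLike¹ : BoxLike U
  star convex⇒boxLike¹ {o} {x} {s} zero o∈ x∈ (inj₁ (o≤s , s≤x)) =
    segment o x (o [ zero ]≔ s) o∈ x∈ o≤s s≤x
  star convex⇒boxLike¹ {o} {x} {s} zero o∈ x∈ (inj₂ (x≤s , s≤o)) =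
    segment x o (o [ zero ]≔ s) x∈ o∈ x≤s s≤o
  span convex⇒boxLike¹ {o} {x} o∈ h x∉ = h zero λ ∈U →
    x∉ (respect U {o [ zero ]≔ x zero} {x} (λ { zero → ≃-refl {x zero} }) ∈U)

-- Realizations by boxes

-1<0 : ℚ.- 1ℚ ℚ.< 0ℚ
-1<0 = ℚₚ.negative⁻¹ (ℚ.- 1ℚ)

-1≤0 : ℚ.- 1ℚ ℚ.≤ 0ℚ
-1≤0 = ℚₚ.<⇒≤ -1<0

0≤1 : 0ℚ ℚ.≤ 1ℚ
0≤1 = ℚₚ.<⇒≤ 0<1

if-≟ : ∀ {n} → Fin n → Fin n → ℚ → ℚ
if-≟ i j q with i Finₚ.≟ j
... | yes _ = q
... | no _  = 0ℚ

if-≟-≡ : ∀ {n} (i : Fin n) q → if-≟ i i q ≡ q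
if-≟-≡ i q with i Finₚ.≟ i
... | yes _  = refl
... | no i≢i = contradiction refl i≢i

if-≟-≢ : ∀ {n} {i j : Fin n} q → i ≢ j → if-≟ i j q ≡ 0ℚ
if-≟-≢ {i = i} {j} q i≢j with i Finₚ.≟ j
... | yes i≡j = contradiction i≡j i≢j
... | no _    = refl

if-≟-disjoint : ∀ {n} {i j : Fin n} k q → i ≢ j → if-≟ k i q ≡ 0ℚ ⊎ if-≟ k j q ≡ 0ℚ
if-≟-disjoint {i = i} {j} k q i≢j with k Finₚ.≟ i | k Finₚ.≟ j
... | no _     | _        = inj₁ refl
... | yes _    | no _     = inj₂ refl
... | yes refl | yes refl = contradiction refl i≢j

if-≟-cases : ∀ {n} (P : ℚ → Set) (i j : Fin n) {q} → P q → P 0ℚ → P (if-≟ i j q)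
if-≟-cases P i j Pq P0 with i Finₚ.≟ j
... | yes _ = Pq
... | no _  = P0

-- The index combine k s stands for the segment from 0 to e k if s = 0, to - e k if s = 1.
module _ (d : ℕ) where
  private
    lo hi : Fin (d *ⁿ 2) → Fin d → ℚ
    lo i k = if-≟ (combine k (suc zero)) i (ℚ.- 1ℚ)
    hi i k = if-≟ (combine k zero) i 1ℚ

    lo≤0 : ∀ i k → lo i k ℚ.≤ 0ℚ
    lo≤0 i k = if-≟-cases (ℚ._≤ 0ℚ) (combine k (suc zero)) i -1≤0 ℚₚ.≤-refl

    0≤hi : ∀ i k → 0ℚ ℚ.≤ hi i k
    0≤hi i k = if-≟-cases (0ℚ ℚ.≤_) (combine k zero) i 0≤1 ℚₚ.≤-refl

    lo≤hi : ∀ i k → lo i k ℚ.≤ hi i k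
    lo≤hi i k = ℚₚ.≤-trans (lo≤0 i k) (0≤hi i k)

    -1≤lo : ∀ i k → ℚ.- 1ℚ ℚ.≤ lo i k
    -1≤lo i k = if-≟-cases (ℚ.- 1ℚ ℚ.≤_) (combine k (suc zero)) i ℚₚ.≤-refl -1≤0

    hi≤1 : ∀ i k → hi i k ℚ.≤ 1ℚ
    hi≤1 i k = if-≟-cases (ℚ._≤ 1ℚ) (combine k zero) i ℚₚ.≤-refl 0≤1

    segments : Vector (Region d) (d *ⁿ 2)
    mem     (segments i) p = ∀ k → const (lo i k) ≤ p k × p k ≤ const (hi i k)
    respect (segments i) {p} {q} p≋q h k =
      ≤-trans {const (lo i k)} {p k} {q k} (proj₁ (h k)) (≃⇒≤ {p k} {q k} (p≋q k)) ,
      ≤-trans {q k} {p k} {const (hi i k)} (≃⇒≤ {q k} {p k} (≃-sym {p k} {q k} (p≋q k))) (proj₂ (h k))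

    -- For each k only one index has a lower bound other than 0, and only one such an upper bound.
    -- Two distinct indices therefore squeeze `p k` to 0, which satisfies the bounds of every
    -- segment.
    meet : ∀ {i j p} → i ≢ j → p ∈ᴿ segments i → p ∈ᴿ segments j → ∀ l → p ∈ᴿ segments l
    meet {i} {j} {p} i≢j pi pj l k =
      ≤-trans {const (lo l k)} {0ℝ} {p k} (const-≤ (lo≤0 l k))
        (lower (if-≟-disjoint (combine k (suc zero)) (ℚ.- 1ℚ) i≢j)) ,
      ≤-trans {p k} {0ℝ} {const (hi l k)}
        (upper (if-≟-disjoint (combine k zero) 1ℚ i≢j)) (const-≤ (0≤hi l k))
      where
      lower : lo i k ≡ 0ℚ ⊎ lo j k ≡ 0ℚ → 0ℝ ≤ p k
      lower (inj₁ eq) = subst (λ q → const q ≤ p k) eq (proj₁ (pi k))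
      lower (inj₂ eq) = subst (λ q → const q ≤ p k) eq (proj₁ (pj k))
      upper : hi i k ≡ 0ℚ ⊎ hi j k ≡ 0ℚ → p k ≤ 0ℝ
      upper (inj₁ eq) = subst (λ q → p k ≤ const q) eq (proj₂ (pi k))
      upper (inj₂ eq) = subst (λ q → p k ≤ const q) eq (proj₂ (pj k))

    private-point : ∀ i → ∃[ p ] (p ∈ᴿ segments i × (∀ j → i ≢ j → ¬ p ∈ᴿ segments j))
    private-point i with Finₚ.combine-surjective {d} {2} i
    ... | k , zero , refl = (λ l → const (hi i l)) ,
      (λ l → const-≤ (lo≤hi i l) , const-≤ (ℚₚ.≤-refl {hi i l})) ,
      λ j i≢j h → proj₂ (h k) (const-< (subst₂ ℚ._<_
        (sym (if-≟-≢ 1ℚ i≢j)) (sym (if-≟-≡ i 1ℚ)) 0<1))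
    ... | k , suc zero , refl = (λ l → const (lo i l)) ,
      (λ l → const-≤ (ℚₚ.≤-refl {lo i l}) , const-≤ (lo≤hi i l)) ,
      λ j i≢j h → proj₁ (h k) (const-< (subst₂ ℚ._<_
        (sym (if-≟-≡ i (ℚ.- 1ℚ))) (sym (if-≟-≢ (ℚ.- 1ℚ) i≢j)) -1<0))

  box-realization : Fin d → Realization Box (𝓕 (d *ⁿ 2)) d
  box-realization k = record
    { sets = segments
    ; kind = λ i → inj₂ ((λ l → const (lo i l)) , (λ l → const (hi i l)) ,
        (λ l → const-≤ (lo≤hi i l)) , id , id)
    ; bounded = λ i → 1ℝ , λ p h l →
        ≤-trans { - 1ℝ} {const (lo i l)} {p l} (const-≤ (-1≤lo i l)) (proj₁ (h l)) ,
        ≤-trans {p l} {const (hi i l)} {1ℝ} (proj₂ (h l)) (const-≤ (hi≤1 i l))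
    ; realizes = realizes-𝓕 {𝓤 = segments} (λ {i} {j} {p} → meet {i} {j} {p})
        ((λ _ → 0ℝ) , λ i l → const-≤ (lo≤0 i l) , const-≤ (0≤hi i l))
        private-point
        -- The empty codeword comes from the point (2, ..., 2), which exceeds the upper bound 1 at
        -- the given coordinate `k`.
        ((λ _ → const (1ℚ ℚ.+ 1ℚ)) , λ i h → proj₂ (h k)
          (const-< (ℚₚ.≤-<-trans (hi≤1 i k) (ℚₚ.+-monoʳ-< 1ℚ 0<1)))) }

-- Realizations by convex polygons

record Affine : Set where
  constructor affine
  field
    x-coeff y-coeff offset : ℚ

open Affine

⟦_⟧ᵃ : Affine → ℝ^ 2 → ℝ
⟦ affine a b c ⟧ᵃ p = const a * p zero + const b * p (suc zero) + const c

value : Affine → ℚ → ℚ → ℚ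
value (affine a b c) u v = a ℚ.* u ℚ.+ b ℚ.* v ℚ.+ c

-- Uniform continuity of affine maps, one-sided and on sequences. It is the common source of
-- `respect`, closedness and openness of the polygons.
modulus : ∀ F {δ} → 0ℚ ℚ.< δ → Σ[ ρ ∈ ℚ ] 0ℚ ℚ.< ρ × (∀ p q →
  (∀ k → Eventually (λ n → ℚ.∣ seq (p k) n ℚ.- seq (q k) n ∣ ℚ.< ρ)) →
  Eventually (λ n → seq (⟦ F ⟧ᵃ p) n ℚ.< seq (⟦ F ⟧ᵃ q) n ℚ.+ δ))
modulus (affine a b c) {δ} 0<δ =
  let ρ , 0<ρ , close = affine-modulus a b 0<δ
  in ρ , 0<ρ , λ p q h → eventually-zip (λ n → close c _ _ _ _) (h zero) (h (suc zero))

⟦⟧-cong : ∀ F {p q} → p ≋ q → ⟦ F ⟧ᵃ p ≃ ⟦ F ⟧ᵃ q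
⟦⟧-cong F {p} {q} p≋q ε 0<ε =
  let ρ , 0<ρ , close = modulus F 0<ε
  in eventually-zip (λ n → <⇒∣-∣<)
       (close p q (λ k → p≋q k ρ 0<ρ))
       (close q p (λ k → ≃-sym {p k} {q k} (p≋q k) ρ 0<ρ))

ball⇒close : ∀ {d ρ} {p q : ℝ^ d} → Ball p (const ρ) q →
  ∀ k → Eventually (λ n → ℚ.∣ seq (q k) n ℚ.- seq (p k) n ∣ ℚ.< ρ)
ball⇒close {d} {ρ} {p} {q} ball k with ball k
... | (ε , 0<ε , p-r<q) , (ε′ , 0<ε′ , q<p+r) = eventually-zip
  (λ n h h′ → <⇒∣-∣< {seq (q k) n} {seq (p k) n}
    (0<⇒< (+-pos (<⇒0< h′) 0<ε′)
      (solve 4 (λ p q r e → (p :+ r :- (q :+ e)) :+ e := p :+ r :- q) refl (seq (p k) n) (seq (q k) n) ρ ε′))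
    (0<⇒< (+-pos (<⇒0< h) 0<ε)
      (solve 4 (λ p q r e → (q :- (p :- r :+ e)) :+ e := q :+ r :- p) refl (seq (p k) n) (seq (q k) n) ρ ε)))
  p-r<q q<p+r

shift-gap : ∀ {a b ε} → 0ℚ ℚ.+ ε ℚ.< a → a ℚ.< b ℚ.+ ε ℚ.* ½ → 0ℚ ℚ.+ ε ℚ.* ½ ℚ.< b
shift-gap {a} {b} {ε} h k = 0<⇒< (+-pos (<⇒0< h) (<⇒0< k))
  (solve 3 (λ a b e → (a :- (con 0ℚ :+ e)) :+ (b :+ e :* con ½ :- a) := b :- (con 0ℚ :+ e :* con ½))
    refl a b ε)

shift-gap-neg : ∀ {a b ε} → a ℚ.+ ε ℚ.< 0ℚ → b ℚ.< a ℚ.+ ε ℚ.* ½ → b ℚ.+ ε ℚ.* ½ ℚ.< 0ℚ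
shift-gap-neg {a} {b} {ε} h k = 0<⇒< (+-pos (<⇒0< h) (<⇒0< k))
  (solve 3 (λ a b e → (con 0ℚ :- (a :+ e)) :+ (a :+ e :* con ½ :- b) := con 0ℚ :- (b :+ e :* con ½))
    refl a b ε)

-- Abstracts `0ℝ <_` and `0ℝ ≤_`, so that the open and the closed polygons share one construction;
-- only their topology is treated separately.
record IsPositivity (Pos : ℝ → Set) : Set where
  field
    resp-≃  : ∀ {x y} → x ≃ y → Pos x → Pos y
    convex  : ∀ {x y t} → Pos x → Pos y → 0ℝ ≤ t → t ≤ 1ℝ → Pos ((1ℝ - t) * x + t * y)
    of-pos  : ∀ {q} → 0ℚ ℚ.< q → Pos (const q)
    of-neg  : ∀ {q} → q ℚ.< 0ℚ → ¬ Pos (const q)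
    nonNeg  : ∀ {x} → Pos x → 0ℝ ≤ x

<-positivity : IsPositivity (0ℝ <_)
<-positivity = record
  { resp-≃ = λ { {x} {y} x≃y (ε , 0<ε , h) → ε ℚ.* ½ , half-pos 0<ε ,
      eventually-zip (λ n k l → shift-gap {seq x n} {seq y n} {ε} k (∣-∣<⇒< l)) h
        (x≃y (ε ℚ.* ½) (half-pos 0<ε)) }
  ; convex = λ {x} {y} {t} → convex-pos {x} {y} {t}
  ; of-pos = const-<
  ; of-neg = λ {q} q<0 → <⇒≤ {const q} {0ℝ} (const-< q<0)
  ; nonNeg = λ {x} → <⇒≤ {0ℝ} {x}
  }

≤-positivity : IsPositivity (0ℝ ≤_)
≤-positivity = record
  { resp-≃ = λ {x} {y} x≃y 0≤x → ≤-trans {0ℝ} {x} {y} 0≤x (≃⇒≤ {x} {y} x≃y)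
  ; convex = λ {x} {y} {t} → convex-nonNeg {x} {y} {t}
  ; of-pos = λ 0<q → const-≤ (ℚₚ.<⇒≤ 0<q)
  ; of-neg = λ q<0 0≤q → 0≤q (const-< q<0)
  ; nonNeg = id
  }

module _ {Pos : ℝ → Set} (positivity : IsPositivity Pos) {m} (F : Fin m → Affine) (i : Fin m) where
  open IsPositivity positivity

  -- All the half-planes F l > 0 (or ≥ 0) except the one with index i.
  polygon : Region 2
  mem     polygon p = ∀ l → l ≢ i → Pos (⟦ F l ⟧ᵃ p)
  respect polygon {p} {q} p≋q h l l≢i =
    resp-≃ {⟦ F l ⟧ᵃ p} {⟦ F l ⟧ᵃ q} (⟦⟧-cong (F l) {p} {q} p≋q) (h l l≢i)

  polygon-convex : Convex polygon
  polygon-convex p q t p∈ q∈ 0≤t t≤1 l l≢i = resp-≃ {(1ℝ - t) * Fp + t * Fq} {⟦ F l ⟧ᵃ r}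
    (≡⇒≃ {(1ℝ - t) * Fp + t * Fq} {⟦ F l ⟧ᵃ r} λ n →
      solve 8 (λ a b c x y x′ y′ t →
          (con 1ℚ :- t) :* (a :* x :+ b :* y :+ c) :+ t :* (a :* x′ :+ b :* y′ :+ c)
          := a :* ((con 1ℚ :- t) :* x :+ t :* x′) :+ b :* ((con 1ℚ :- t) :* y :+ t :* y′) :+ c)
        refl (x-coeff (F l)) (y-coeff (F l)) (offset (F l))
        (seq (p zero) n) (seq (p (suc zero)) n) (seq (q zero) n) (seq (q (suc zero)) n) (seq t n))
    (convex {Fp} {Fq} {t} (p∈ l l≢i) (q∈ l l≢i) 0≤t t≤1)
    where
    Fp Fq : ℝ
    Fp = ⟦ F l ⟧ᵃ p
    Fq = ⟦ F l ⟧ᵃ q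
    r : ℝ^ 2
    r k = (1ℝ - t) * p k + t * q k

polygon-closed : ∀ {m} (F : Fin m → Affine) i → Closed (polygon ≤-positivity F i)
polygon-closed F i p limit l l≢i (ε , 0<ε , Fp<0) =
  let ρ , 0<ρ , close = modulus (F l) (half-pos 0<ε)
      q , q∈ , ball   = limit (const ρ) (const-< 0<ρ)
  in q∈ l l≢i (ε ℚ.* ½ , half-pos 0<ε , eventually-zip
       (λ n → shift-gap-neg {seq (⟦ F l ⟧ᵃ p) n} {seq (⟦ F l ⟧ᵃ q) n}) Fp<0
       (close q p (ball⇒close {ρ = ρ} {p} {q} ball)))

common-radius : ∀ {m} {P : Fin m → ℚ → Set} → (∀ {l ρ ρ′} → ρ ℚ.≤ ρ′ → P l ρ′ → P l ρ) →
  (∀ l → Σ[ ρ ∈ ℚ ] 0ℚ ℚ.< ρ × P l ρ) → Σ[ ρ ∈ ℚ ] 0ℚ ℚ.< ρ × (∀ l → P l ρ)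
common-radius {zero}  antitone h = 1ℚ , 0<1 , λ ()
common-radius {suc m} antitone h =
  let ρ₀ , 0<ρ₀ , P₀ = h zero
      ρ₁ , 0<ρ₁ , P₁ = common-radius antitone (h ∘ suc)
      ρ , 0<ρ , ρ≤ρ₀ , ρ≤ρ₁ = common-lower-bound 0<ρ₀ 0<ρ₁
  in ρ , 0<ρ , λ { zero → antitone ρ≤ρ₀ P₀ ; (suc l) → antitone ρ≤ρ₁ (P₁ l) }

ball-mono : ∀ {d ρ ρ′} {p q : ℝ^ d} → ρ ℚ.≤ ρ′ → Ball p (const ρ) q → Ball p (const ρ′) q
ball-mono {d} {ρ} {ρ′} {p} {q} ρ≤ρ′ ball k with ball k
... | (ε , 0<ε , h) , (ε′ , 0<ε′ , h′) =
  (ε , 0<ε , eventually-map (λ n lt → 0<⇒< (+-pos-nonNeg (<⇒0< lt) (≤⇒0≤ ρ≤ρ′))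
    (solve 5 (λ p q r r′ e → (q :- (p :- r :+ e)) :+ (r′ :- r) := q :- (p :- r′ :+ e)) refl
      (seq (p k) n) (seq (q k) n) ρ ρ′ ε)) h) ,
  (ε′ , 0<ε′ , eventually-map (λ n lt → 0<⇒< (+-pos-nonNeg (<⇒0< lt) (≤⇒0≤ ρ≤ρ′))
    (solve 5 (λ p q r r′ e → (p :+ r :- (q :+ e)) :+ (r′ :- r) := p :+ r′ :- (q :+ e)) refl
      (seq (p k) n) (seq (q k) n) ρ ρ′ ε′)) h′)

polygon-open : ∀ {m} (F : Fin m → Affine) i → Open (polygon <-positivity F i)
polygon-open {m} F i p p∈ =
  let ρ , 0<ρ , inside = common-radius {P = Inside} antitone radius
  in const ρ , const-< 0<ρ , λ q ball l → inside l q ball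
  where
  Inside : Fin m → ℚ → Set
  Inside l ρ = ∀ q → Ball p (const ρ) q → l ≢ i → 0ℝ < ⟦ F l ⟧ᵃ q
  antitone : ∀ {l ρ ρ′} → ρ ℚ.≤ ρ′ → Inside l ρ′ → Inside l ρ
  antitone ρ≤ρ′ h q ball = h q (ball-mono {p = p} {q} ρ≤ρ′ ball)
  radius : ∀ l → Σ[ ρ ∈ ℚ ] 0ℚ ℚ.< ρ × Inside l ρ
  radius l with l Finₚ.≟ i
  -- The omitted half-plane imposes no condition, so the radius 1 is an arbitrary default.
  ... | yes l≡i = 1ℚ , 0<1 , λ _ _ l≢i → contradiction l≡i l≢i
  ... | no l≢i  =
    let ε , 0<ε , ε<Fp  = p∈ l l≢i
        ρ , 0<ρ , close = modulus (F l) (half-pos 0<ε)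
    in ρ , 0<ρ , λ q ball _ → ε ℚ.* ½ , half-pos 0<ε , eventually-zip
         (λ n → shift-gap {seq (⟦ F l ⟧ᵃ p) n} {seq (⟦ F l ⟧ᵃ q) n} {ε}) ε<Fp
         (close p q λ k → eventually-map
           (λ n → subst (ℚ._< ρ) (∣p-q∣≡∣q-p∣ (seq (q k) n) (seq (p k) n)))
           (ball⇒close {ρ = ρ} {p} {q} ball k))

point : ℚ → ℚ → ℝ^ 2
point u v zero    = const u
point u v (suc _) = const v

-- Every point (i , i² - ½) lies below the tangent y = 2 i x - i² of the parabola
-- y = x² but above the tangents at the other integers.
module _ (n : ℕ) where
  private
    N M : ℚ
    N = fromℕ n
    -- N bounds the abscissas i and N² the ordinates i² - ½; the remaining slack keeps these points
    -- and (0 , 1) strictly inside the square.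
    M = N ℚ.* N ℚ.+ N ℚ.+ (1ℚ ℚ.+ 1ℚ)

    0≤N : 0ℚ ℚ.≤ N
    0≤N = fromℕ-nonNeg n

    0<2 : 0ℚ ℚ.< 1ℚ ℚ.+ 1ℚ
    0<2 = +-pos 0<1 0<1

    0≤N²+N : 0ℚ ℚ.≤ N ℚ.* N ℚ.+ N
    0≤N²+N = +-nonNeg (*-nonNeg 0≤N 0≤N) 0≤N

    X Y : Fin n → ℚ
    X i = fromℕ (toℕ i)
    Y i = X i ℚ.* X i ℚ.- ½

    0≤X : ∀ i → 0ℚ ℚ.≤ X i
    0≤X i = fromℕ-nonNeg (toℕ i)

    0≤N-X : ∀ i → 0ℚ ℚ.≤ N ℚ.- X i
    0≤N-X i = ℚₚ.≤-trans 0≤1 (fromℕ-< (Finₚ.toℕ<n i))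

    -- The half-planes with index below 4 bound the square [-M , M]².
    half-plane : Fin (4 +ⁿ n) → Affine
    half-plane zero                      = affine (ℚ.- 1ℚ) 0ℚ M
    half-plane (suc zero)                = affine 1ℚ 0ℚ M
    half-plane (suc (suc zero))          = affine 0ℚ (ℚ.- 1ℚ) M
    half-plane (suc (suc (suc zero)))    = affine 0ℚ 1ℚ M
    half-plane (suc (suc (suc (suc j)))) = affine (ℚ.- (X j ℚ.+ X j)) 1ℚ (X j ℚ.* X j)

    tangent : Fin n → Fin (4 +ⁿ n)
    tangent j = suc (suc (suc (suc j)))

    tangent-injective : ∀ {i j} → tangent i ≡ tangent j → i ≡ j
    tangent-injective refl = refl

    -- The tangent at j meets the y-axis at -j², below the point (0 , 1), which thus gives the
    -- codeword [n].
    value-at-centre : ∀ l → 0ℚ ℚ.< value (half-plane l) 0ℚ 1ℚ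
    value-at-centre zero = subst (0ℚ ℚ.<_)
      (solve 1 (λ N → con (1ℚ ℚ.+ 1ℚ) :+ (N :* N :+ N)
         := con (ℚ.- 1ℚ) :* con 0ℚ :+ con 0ℚ :* con 1ℚ :+ (N :* N :+ N :+ con (1ℚ ℚ.+ 1ℚ))) refl N)
      (+-pos-nonNeg 0<2 0≤N²+N)
    value-at-centre (suc zero) = subst (0ℚ ℚ.<_)
      (solve 1 (λ N → con (1ℚ ℚ.+ 1ℚ) :+ (N :* N :+ N)
         := con 1ℚ :* con 0ℚ :+ con 0ℚ :* con 1ℚ :+ (N :* N :+ N :+ con (1ℚ ℚ.+ 1ℚ))) refl N)
      (+-pos-nonNeg 0<2 0≤N²+N)
    value-at-centre (suc (suc zero)) = subst (0ℚ ℚ.<_)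
      (solve 1 (λ N → con 1ℚ :+ (N :* N :+ N)
         := con 0ℚ :* con 0ℚ :+ con (ℚ.- 1ℚ) :* con 1ℚ :+ (N :* N :+ N :+ con (1ℚ ℚ.+ 1ℚ))) refl N)
      (+-pos-nonNeg 0<1 0≤N²+N)
    value-at-centre (suc (suc (suc zero))) = subst (0ℚ ℚ.<_)
      (solve 1 (λ N → con 1ℚ :+ con (1ℚ ℚ.+ 1ℚ) :+ (N :* N :+ N)
         := con 0ℚ :* con 0ℚ :+ con 1ℚ :* con 1ℚ :+ (N :* N :+ N :+ con (1ℚ ℚ.+ 1ℚ))) refl N)
      (+-pos-nonNeg (+-pos 0<1 0<2) 0≤N²+N)
    value-at-centre (suc (suc (suc (suc j)))) = subst (0ℚ ℚ.<_)
      (solve 1 (λ z → con 1ℚ :+ z :* z := (:- (z :+ z)) :* con 0ℚ :+ con 1ℚ :* con 1ℚ :+ z :* z) refl (X j))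
      (+-pos-nonNeg 0<1 (*-nonNeg (0≤X j) (0≤X j)))

    -- The parabola runs (x - j)² above its tangent at j. Lowering it by ½ makes the value negative
    -- at x = j and leaves it at least ½ at all other integers.
    tangent-value : ∀ j x → (x ℚ.- X j) ℚ.* (x ℚ.- X j) ℚ.- ½ ≡ value (half-plane (tangent j)) x (x ℚ.* x ℚ.- ½)
    tangent-value j x = solve 2 (λ x z → (x :- z) :* (x :- z) :- con ½
      := (:- (z :+ z)) :* x :+ con 1ℚ :* (x :* x :- con ½) :+ z :* z) refl x (X j)

    value-at-vertex : ∀ i l → l ≢ tangent i → 0ℚ ℚ.< value (half-plane l) (X i) (Y i)
    value-at-vertex i zero _ = subst (0ℚ ℚ.<_)
      (solve 2 (λ N x → con (1ℚ ℚ.+ 1ℚ) :+ (N :* N :+ (N :- x))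
         := con (ℚ.- 1ℚ) :* x :+ con 0ℚ :* (x :* x :- con ½) :+ (N :* N :+ N :+ con (1ℚ ℚ.+ 1ℚ))) refl N (X i))
      (+-pos-nonNeg 0<2 (+-nonNeg (*-nonNeg 0≤N 0≤N) (0≤N-X i)))
    value-at-vertex i (suc zero) _ = subst (0ℚ ℚ.<_)
      (solve 2 (λ N x → con (1ℚ ℚ.+ 1ℚ) :+ (N :* N :+ N :+ x)
         := con 1ℚ :* x :+ con 0ℚ :* (x :* x :- con ½) :+ (N :* N :+ N :+ con (1ℚ ℚ.+ 1ℚ))) refl N (X i))
      (+-pos-nonNeg 0<2 (+-nonNeg 0≤N²+N (0≤X i)))
    value-at-vertex i (suc (suc zero)) _ = subst (0ℚ ℚ.<_)
      (solve 2 (λ N x → con (½ ℚ.+ (1ℚ ℚ.+ 1ℚ)) :+ ((N :- x) :* (N :+ x) :+ N)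
         := con 0ℚ :* x :+ con (ℚ.- 1ℚ) :* (x :* x :- con ½) :+ (N :* N :+ N :+ con (1ℚ ℚ.+ 1ℚ))) refl N (X i))
      (+-pos-nonNeg (+-pos 0<½ 0<2) (+-nonNeg (*-nonNeg (0≤N-X i) (+-nonNeg 0≤N (0≤X i))) 0≤N))
    value-at-vertex i (suc (suc (suc zero))) _ = subst (0ℚ ℚ.<_)
      (solve 2 (λ N x → con (½ ℚ.+ 1ℚ) :+ (x :* x :+ (N :* N :+ N))
         := con 0ℚ :* x :+ con 1ℚ :* (x :* x :- con ½) :+ (N :* N :+ N :+ con (1ℚ ℚ.+ 1ℚ))) refl N (X i))
      (+-pos-nonNeg (+-pos 0<½ 0<1) (+-nonNeg (*-nonNeg (0≤X i) (0≤X i)) 0≤N²+N))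
    value-at-vertex i (suc (suc (suc (suc j)))) l≢ with ℕₚ.<-cmp (toℕ i) (toℕ j)
    ... | tri< i<j _ _ = subst (0ℚ ℚ.<_)
      (trans (solve 2 (λ x z → (z :- x) :* (z :- x) :- con ½ := (x :- z) :* (x :- z) :- con ½) refl (X i) (X j))
        (tangent-value j (X i)))
      (½<square (fromℕ-< i<j))
    ... | tri≈ _ i≡j _ = contradiction (cong tangent (sym (Finₚ.toℕ-injective i≡j))) l≢
    ... | tri> _ _ j<i = subst (0ℚ ℚ.<_) (tangent-value j (X i)) (½<square (fromℕ-< j<i))

    value-at-own-vertex : ∀ i → value (half-plane (tangent i)) (X i) (Y i) ℚ.< 0ℚ
    value-at-own-vertex i = 0<⇒< 0<½
      (trans (solve 1 (λ x → con ½ := con 0ℚ :- ((x :- x) :* (x :- x) :- con ½)) refl (X i))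
        (cong (λ z → 0ℚ ℚ.- z) (tangent-value i (X i))))

    -- Every polygon keeps the four sides of the square, so a point under the lower side gives the
    -- empty codeword.
    below : value (half-plane (suc (suc (suc zero)))) 0ℚ (ℚ.- (M ℚ.+ 1ℚ)) ℚ.< 0ℚ
    below = 0<⇒< 0<1
      (solve 1 (λ M → con 1ℚ := con 0ℚ :- (con 0ℚ :* con 0ℚ :+ con 1ℚ :* (:- (M :+ con 1ℚ)) :+ M)) refl M)

  module _ {Pos : ℝ → Set} (positivity : IsPositivity Pos) where
    open IsPositivity positivity

    polygons : Vector (Region 2) n
    polygons i = polygon positivity half-plane (tangent i)

    private
      at-point : ∀ F u v → const (value F u v) ≃ ⟦ F ⟧ᵃ (point u v)
      at-point F u v = ≡⇒≃ {const (value F u v)} {⟦ F ⟧ᵃ (point u v)} λ n → refl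

      pos-at : ∀ F u v → 0ℚ ℚ.< value F u v → Pos (⟦ F ⟧ᵃ (point u v))
      pos-at F u v h = resp-≃ {const (value F u v)} {⟦ F ⟧ᵃ (point u v)} (at-point F u v) (of-pos h)

      neg-at : ∀ F u v → value F u v ℚ.< 0ℚ → ¬ Pos (⟦ F ⟧ᵃ (point u v))
      neg-at F u v h P = of-neg h (resp-≃ {⟦ F ⟧ᵃ (point u v)} {const (value F u v)}
        (≃-sym {const (value F u v)} {⟦ F ⟧ᵃ (point u v)} (at-point F u v)) P)

    polygons-bounded : ∀ i → Bounded (polygons i)
    polygons-bounded i = const M , λ p p∈ → λ
      { zero →
          coordinate (suc zero) (λ ()) p p∈ (- const M) (p zero) (λ n →
            solve 3 (λ x y M → con 1ℚ :* x :+ con 0ℚ :* y :+ M := x :- :- M) refl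
              (seq (p zero) n) (seq (p (suc zero)) n) M)
        , coordinate zero (λ ()) p p∈ (p zero) (const M) (λ n →
            solve 3 (λ x y M → con (ℚ.- 1ℚ) :* x :+ con 0ℚ :* y :+ M := M :- x) refl
              (seq (p zero) n) (seq (p (suc zero)) n) M)
      ; (suc zero) →
          coordinate (suc (suc (suc zero))) (λ ()) p p∈ (- const M) (p (suc zero)) (λ n →
            solve 3 (λ x y M → con 0ℚ :* x :+ con 1ℚ :* y :+ M := y :- :- M) refl
              (seq (p zero) n) (seq (p (suc zero)) n) M)
        , coordinate (suc (suc zero)) (λ ()) p p∈ (p (suc zero)) (const M) (λ n →
            solve 3 (λ x y M → con 0ℚ :* x :+ con (ℚ.- 1ℚ) :* y :+ M := M :- y) refl
              (seq (p zero) n) (seq (p (suc zero)) n) M) }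
      where
      coordinate : ∀ l → l ≢ tangent i → ∀ p → p ∈ᴿ polygons i → ∀ x y →
        (∀ n → seq (⟦ half-plane l ⟧ᵃ p) n ≡ seq (y - x) n) → x ≤ y
      coordinate l l≢ p p∈ x y eq = 0≤⇒≤ᴿ {x} {y}
        (≤-respʳ-≡ {0ℝ} {⟦ half-plane l ⟧ᵃ p} {y - x} (nonNeg (p∈ l l≢)) eq)

    polygons-meet : ∀ {i j p} → i ≢ j → p ∈ᴿ polygons i → p ∈ᴿ polygons j → ∀ k → p ∈ᴿ polygons k
    polygons-meet {i} i≢j pi pj k l _ with l Finₚ.≟ tangent i
    -- The half-plane omitted from polygon i is imposed by polygon j.
    ... | yes refl = pj l λ eq → i≢j (tangent-injective eq)
    ... | no l≢    = pi l l≢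

    polygons-realize-𝓕 : code polygons ≐ 𝓕 n
    polygons-realize-𝓕 = realizes-𝓕 {𝓤 = polygons} (λ {i} {j} {p} → polygons-meet {i} {j} {p})
      (point 0ℚ 1ℚ , λ i l _ → pos-at (half-plane l) 0ℚ 1ℚ (value-at-centre l))
      (λ i → point (X i) (Y i) ,
        (λ l l≢ → pos-at (half-plane l) (X i) (Y i) (value-at-vertex i l l≢)) ,
        (λ j i≢j h → neg-at (half-plane (tangent i)) (X i) (Y i) (value-at-own-vertex i)
          (h (tangent i) λ eq → i≢j (tangent-injective eq))))
      (point 0ℚ (ℚ.- (M ℚ.+ 1ℚ)) , λ i h →
        neg-at (half-plane (suc (suc (suc zero)))) 0ℚ (ℚ.- (M ℚ.+ 1ℚ)) below (h (suc (suc (suc zero))) λ ()))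

  open-realization : Realization (λ U → Open U × Convex U) (𝓕 n) 2
  open-realization = record
    { sets     = polygons <-positivity
    ; kind     = λ i → polygon-open half-plane (tangent i) ,
                       polygon-convex <-positivity half-plane (tangent i)
    ; bounded  = polygons-bounded <-positivity
    ; realizes = polygons-realize-𝓕 <-positivity
    }

  closed-realization : Realization (λ U → Closed U × Convex U) (𝓕 n) 2
  closed-realization = record
    { sets     = polygons ≤-positivity
    ; kind     = λ i → polygon-closed half-plane (tangent i) ,
                       polygon-convex ≤-positivity half-plane (tangent i)
    ; bounded  = polygons-bounded ≤-positivity
    ; realizes = polygons-realize-𝓕 ≤-positivity
    }

-- The dimensions of `𝓕 n`

boxLike-bound : ∀ {n d} {𝓤 : Vector (Region d) n} → 4 ≤ⁿ n →
  (∀ i → BoxLike (𝓤 i)) → code 𝓤 ≐ 𝓕 n → n ≤ⁿ d *ⁿ 2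
boxLike-bound (s≤s (s≤s _)) = dimension-bound

convex-bound : ∀ {n d} {𝓤 : Vector (Region d) n} → 4 ≤ⁿ n →
  (∀ i → Convex (𝓤 i)) → code 𝓤 ≐ 𝓕 n → 2 ≤ⁿ d
convex-bound {d = zero} {𝓤} 4≤n convex realizes =
  contradiction (ℕₚ.≤-trans 4≤n (boxLike-bound {𝓤 = 𝓤} 4≤n (λ i → convex⇒boxLike⁰ (convex i)) realizes)) λ ()
convex-bound {d = suc zero} {𝓤} 4≤n convex realizes =
  contradiction (ℕₚ.≤-trans 4≤n (boxLike-bound {𝓤 = 𝓤} 4≤n (λ i → convex⇒boxLike¹ (convex i)) realizes))
    λ { (s≤s (s≤s ())) }
convex-bound {d = suc (suc d)} _ _ _ = s≤s (s≤s z≤n)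

theorem15 : ∀ (n : ℕ) → 2 ∣ n → 4 ≤ⁿ n →
    (bdim 𝓕 n ≡ [ n / 2 ]) × (odim 𝓕 n ≡ [ 2 ]) × (cdim 𝓕 n ≡ [ 2 ])
theorem15 n (divides q refl) 4≤n =
  subst (λ d → bdim 𝓕 n ≡ [ d ]) (sym (m*n/n≡m q 2)) (bdim-𝓕 q 4≤n) ,
  attained (open-realization n)
    (λ d R → convex-bound {𝓤 = sets R} 4≤n (λ i → proj₂ (kind R i)) (realizes R)) ,
  attained (closed-realization n)
    (λ d R → convex-bound {𝓤 = sets R} 4≤n (λ i → proj₂ (kind R i)) (realizes R))
  where
  open Realization
  bdim-𝓕 : ∀ q → 4 ≤ⁿ q *ⁿ 2 → bdim 𝓕 (q *ⁿ 2) ≡ [ q ]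
  -- 4 ≤ 2 q rules out q = 0, which supplies the coordinate `zero` for `box-realization`.
  bdim-𝓕 (suc q) 4≤n = attained (box-realization (suc q) zero) λ d R →
    ℕₚ.*-cancelʳ-≤ (suc q) d 2 (boxLike-bound {𝓤 = sets R} 4≤n (λ i → box⇒boxLike (kind R i)) (realizes R))
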